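{- Let $m,r,n\in\mathbb N$ with $m+r=n$ and put $k=n-1$. Let $\lambda,\mu,\nu\subseteq R_r=(r^m)$ be partitions and $d\in\mathbb Z_{\ge 0}$ with $|\lambda|+|\mu|=|\nu|+nd$. Then the diagram $\mathrm{QH}^*(\mathrm{Gr}_{m,n})\xrightarrow{\Gamma_{\mathrm{SD}}}\mathrm{QH}^*(\mathrm{Gr}_{m,n})\xrightarrow{\Psi_{\mathrm{PC}}}\mathrm{QH}^*(\mathrm{Fl}_n)\xrightarrow{\Gamma_{\mathrm T}}\mathrm{QH}^*(\mathrm{Fl}_n)$ versus $\mathrm{QH}^*(\mathrm{Gr}_{m,n})\xrightarrow{\Phi_{\mathrm{Gr}}}\mathrm H_*(\mathcal Gr_n)\xrightarrow{\Phi_{\mathrm{Fl}}}\mathrm{QH}^*(\mathrm{Fl}_n)$ on Littlewood–Richardson coefficients commutes, i.e. $$\Gamma_{\mathrm T}\circ\Psi_{\mathrm{PC}}\circ\Gamma_{\mathrm{SD}}\big(c_{\lambda,\mu}^{\nu,d}\big)=\Phi_{\mathrm{Fl}}\circ\Phi_{\mathrm{Gr}}\big(c_{\lambda,\mu}^{\nu,d}\big).$$ Explicitly: with $t=\mathrm{diag}_0(\nu^\vee)-d$ and $s=\mathrm{diag}_0((\nu\oplus d)^{\vee_r})$, the quantum Littlewood–Richardson coefficient of $\mathrm{QH}^*(\mathrm{Fl}_n)$ $$c_{\,w_0w_{\lambda^\vee}w_0,\;w_0w_{\mu^\vee}w_0}^{\,w_0\,w_{\phi^r(\nu)^\vee}\,w_0^P\,w_0^{P'_t}\,w_0,\;(0^{r-t},1,2,\dots,t-1,t,t-1,\dots,1,0^{m-t})}$$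 is the same coefficient (same indexing permutations and same degree vector) as $$c_{\,\varphi_r(\lambda),\;\varphi_r(\mu)}^{\,\varphi_{r-s}(\eta^2)\varphi_{r+s}(\eta^1),\;(0^{r-s},1,2,\dots,s-1,s,s-1,\dots,1,0^{m-s})}.$$
   Context: Partitions are drawn as Ferrers shapes in French notation (row 1 lowest). For $1\le i\le k$, $R_i=(i^{n-i})$ is the rectangle with $i$ columns and $n-i$ rows; in particular $R_r=(r^m)$. For $\lambda=(\lambda_1,\dots,\lambda_{n-j})\subseteq R_j$ its complement is $\lambda^{\vee_j}=(j-\lambda_{n-j},\dots,j-\lambda_1)$; $\lambda^\vee$ means $\lambda^{\vee_r}$ for $\lambda\subseteq R_r$. $\lambda'$ is the transpose partition. $\mathrm{diag}_0(\lambda)$ is the number of cells of $\lambda$ with equal row and column index. The bit string $b_\lambda\in\{0,1\}^n$ of $\lambda\subseteq R_r$ is obtained by tracing the boundary of $\lambda$ from the upper left corner of $R_r$ to its lower right corner, recording a vertical step as 0 and a horizontal step as 1; $\phi^a$ maps $\lambda$ to the partition whose bit string is obtained by moving the first $a$ bits of $b_\lambda$ to the end. Permutations in $S_n$ are written in one-line notation $w=[w(1)\cdots w(n)]$; $w_0=[n\,\cdots\,1]$; for $w\in S_n$, $w'=w_0ww_0$. For a partition $\lambda$ with $j$ parts (padded with zeros) contained in $R_{n-j}$, $w_\lambda\in S_n$ is defined by $w_\lambda(i)=\lambda_{j-i+1}+i$ for $1\le i\le j$, with $w_\lambda(j+1)<\dots<w_\lambda(n)$ the remaining values; for $\eta\subseteq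 R_j$, $\varphi_j(\eta)=w_{(\eta^{\vee_j})'}$ (the transpose $(\eta^{\vee_j})'$ has $j$ rows). $w_0^P=[m\cdots 1\mid n\cdots m+1]$, and for $0\le e\le\min\{m,r\}$, $w_0^{P'_e}=[m-e\cdots1\mid m\cdots m-e+1\mid m+e\cdots m+1\mid n\cdots m+e+1]$ (each block listed in decreasing order). An $n$-rim hook is a connected skew shape with $n$ cells containing no $2\times2$ square; its head is its southeasternmost cell. $\nu\oplus d$ is the partition obtained from $\nu$ by adding $d$ $n$-rim hooks so that all $d$ heads lie in column $r$. $(\nu\oplus d)^{\vee_r}$ denotes the complement in $R_r$ of the part of $\nu\oplus d$ lying inside $R_r$. With $s=\mathrm{diag}_0((\nu\oplus d)^{\vee_r})$, write $\nu\oplus d=(\eta^1,\eta^2)$ where $\eta^1$ consists of the bottom $m-s$ rows of $\nu\oplus d$ and $\eta^2$ of the remaining rows. Quantum Littlewood–Richardson coefficients: in $\mathrm{QH}^*(\mathrm{Gr}_{m,n})$, $\sigma_\lambda*\sigma_\mu=\sum_{\nu\subseteq R_r,d}c_{\lambda,\mu}^{\nu,d}q^d\sigma_\nu$; in $\mathrm{QH}^*(\mathrm{Fl}_n)$, $\sigma_u*\sigma_v=\sum_{w,\mathbf d}c_{u,v}^{w,\mathbf d}\mathbf q^{\mathbf d}\sigma_w$ with $\mathbf d\in\mathbb Z_{\ge0}^k$; the $k$-Littlewood–Richardson coefficients $C_{\lambda,\mu}^{\eta,(k)}$ are defined by $s^{(k)}_\lambda s^{(k)}_\mu=\sum_\eta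 C^{\eta,(k)}_{\lambda,\mu}s^{(k)}_\eta$ for $k$-Schur functions indexed by $k$-bounded partitions. The correspondences act on indices as follows: $\Gamma_{\mathrm{SD}}(c_{\lambda,\mu}^{\nu,d})=c_{\lambda^\vee,\mu^\vee}^{\phi^r(\nu)^\vee,\,\mathrm{diag}_0(\nu^\vee)-d}$; for $u,v,w\in S_n$ Grassmannian with descent only possibly at $m$ and $0\le e\le\min\{m,r\}$, $\Psi_{\mathrm{PC}}(c^{\lambda_w,e}_{\lambda_u,\lambda_v})=c_{u,v}^{ww_0^Pw_0^{P'_e},\,(0^{m-e},1,\dots,e-1,e,e-1,\dots,1,0^{r-e})}$ where $\lambda_w=(w(m)-m,\dots,w(1)-1)$ (inverse to $\lambda\mapsto w_\lambda$); $\Gamma_{\mathrm T}(c_{u,v}^{w,\mathbf d})=c_{u',v'}^{w',\mathbf d'}$ with $d'_i=d_{n-i}$; $\Phi_{\mathrm{Gr}}(c_{\lambda,\mu}^{\nu,d})=C_{\lambda,\mu}^{\nu\oplus d,(k)}$; $\Phi_{\mathrm{Fl}}(C_{\lambda,\mu}^{\nu\oplus d,(k)})=c_{\varphi_r(\lambda),\varphi_r(\mu)}^{\varphi_{r-s}(\eta^2)\varphi_{r+s}(\eta^1),(0^{r-s},1,\dots,s,\dots,1,0^{m-s})}$.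
   Formalization: The hypothesis d ≤ diag_0(ν^∨) is added: otherwise t = diag_0(ν^∨) − d can be negative (e.g. m=2, r=6, λ=μ=(6,6), ν=∅, d=3 gives t=−1), and then w_0^{P'_t} and the degree vector are undefined; m, r ≥ 1 is assumed. -}

module Defs where

open import Data.Nat using (ℕ; zero; suc; _+_; _*_; _∸_; _≤_; _<_; _≤ᵇ_; _≡ᵇ_; ∣_-_∣)
open import Data.Bool using (Bool; true; false; if_then_else_; not)
open import Data.List using (List; []; _∷_; _++_; map; reverse; zipWith; upTo; filterᵇ; length; replicate; take; drop)
open import Data.Nat.ListAction using (sum)
open import Data.Bool.ListAction using (any)
open import Data.Product using (_×_; Σ; ∃; _,_)
open import Relation.Binary.PropositionalEquality using (_≡_)
open import Relation.Nullary using (¬_)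

-- Conventions.
-- A partition is a list of parts (λ₁, λ₂, …) (row 1 = lowest row, French
-- notation), weakly decreasing; trailing zeros are allowed (padding).
-- A permutation of {1..n} is a list of length n in one-line notation.

oneTo : ℕ → List ℕ
oneTo n = map suc (upTo n)

-- i-th entry (1-indexed), 0 if out of range.  For a partition this is the
-- i-th part λᵢ; for a permutation u this is u(i).
row : List ℕ → ℕ → ℕ
row xs zero = 0
row [] (suc i) = 0
row (x ∷ xs) (suc zero) = x
row (x ∷ xs) (suc (suc i)) = row xs (suc i)

Decreasing : List ℕ → Set
Decreasing [] = Data.Unit.⊤ where import Data.Unit
Decreasing (x ∷ []) = Data.Unit.⊤ where import Data.Unit
Decreasing (x ∷ y ∷ xs) = (y ≤ x) × Decreasing (y ∷ xs)

InRect : ℕ → ℕ → List ℕ → Set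
InRect a c lam = (length lam ≡ a) × Decreasing lam × (∀ i → row lam i ≤ c)

-- complement inside R_j of a partition given with exactly n - j parts:
-- λ^{∨_j} = (j - λ_{n-j}, …, j - λ₁)
compl : ℕ → List ℕ → List ℕ
compl j lam = reverse (map (j ∸_) lam)

-- transpose of a partition with parts ≤ c, given as its c column lengths
transp : ℕ → List ℕ → List ℕ
transp c lam = map (λ i → sum (map (λ x → if i ≤ᵇ x then 1 else 0) lam)) (oneTo c)

diag0Aux : ℕ → List ℕ → ℕ
diag0Aux i [] = 0
diag0Aux i (x ∷ xs) = (if i ≤ᵇ x then 1 else 0) + diag0Aux (suc i) xs

diag0 : List ℕ → ℕ
diag0 = diag0Aux 1

-- Bit strings and φ^a, for λ ⊆ R_r given with exactly m parts.
-- Boundary from upper-left to lower-right corner of R_r: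
-- 1^{λ_m} 0 1^{λ_{m-1}-λ_m} 0 … 1^{λ₁-λ₂} 0 1^{r-λ₁}  (0 = vertical, 1 = horizontal)

bitsAux : ℕ → ℕ → List ℕ → List Bool
bitsAux r prev [] = replicate (r ∸ prev) true
bitsAux r prev (x ∷ xs) = replicate (x ∸ prev) true ++ (false ∷ bitsAux r x xs)

bits : ℕ → List ℕ → List Bool
bits r lam = bitsAux r 0 (reverse lam)

-- inverse: the j-th 0 (j = 1..m) sits after λ_{m+1-j} ones
decodeAux : ℕ → List Bool → List ℕ
decodeAux c [] = []
decodeAux c (true ∷ bs) = decodeAux (suc c) bs
decodeAux c (false ∷ bs) = c ∷ decodeAux c bs

decode : List Bool → List ℕ
decode bs = reverse (decodeAux 0 bs)

phiRot : ℕ → ℕ → List ℕ → List ℕ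
phiRot r a lam = decode (drop a (bits r lam) ++ take a (bits r lam))

member : ℕ → List ℕ → Bool
member x xs = any (λ y → x ≡ᵇ y) xs

wOf : ℕ → List ℕ → List ℕ
wOf n lam = first ++ filterᵇ (λ x → not (member x first)) (oneTo n)
  where first = zipWith _+_ (reverse lam) (oneTo (length lam))

comp : List ℕ → List ℕ → List ℕ
comp u v = map (row u) v

down : ℕ → ℕ → List ℕ
down a b = reverse (map (a +_) (oneTo (b ∸ a)))

w0 : ℕ → List ℕ
w0 n = down 0 n

w0P : ℕ → ℕ → List ℕ
w0P n m = down 0 m ++ down m n

w0P' : ℕ → ℕ → ℕ → List ℕ
w0P' n m e = down 0 (m ∸ e) ++ down (m ∸ e) m ++ down m (m + e) ++ down (m + e) n

conj : ℕ → List ℕ → List ℕ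
conj n w = comp (comp (w0 n) w) (w0 n)

-- φ_j(η) = w_{(η^{∨_j})'}  for η ⊆ R_j given with exactly n - j parts
phiJ : ℕ → ℕ → List ℕ → List ℕ
phiJ n j eta = wOf n (transp j (compl j eta))

-- degree vector in ℤ_{≥0}^{n-1} with entries d_i = max(0, e - |i - p|):
-- this is (0^{p-e}, 1, …, e-1, e, e-1, …, 1, 0^{n-p-e}), all zeros if e = 0
degPeak : ℕ → ℕ → ℕ → List ℕ
degPeak n p e = map (λ i → e ∸ ∣ i - p ∣) (oneTo (n ∸ 1))

record GrIdx : Set where
  constructor grIdx
  field
    lamG muG nuG : List ℕ
    degG : ℕ

record FlIdx : Set where
  constructor flIdx
  field
    uF vF wF : List ℕ
    degF : List ℕ

-- C_{λ,μ}^{η,(k)} (k-Littlewood–Richardson)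
record KIdx : Set where
  constructor kIdx
  field
    lamK muK etaK : List ℕ

-- Γ_SD(c_{λ,μ}^{ν,d}) = c_{λ^∨,μ^∨}^{φ^r(ν)^∨, diag₀(ν^∨) - d}
-- (the subtraction is only applied under the hypothesis d ≤ diag₀(ν^∨))
GammaSD : ℕ → GrIdx → GrIdx
GammaSD r (grIdx l u v d) =
  grIdx (compl r l) (compl r u) (compl r (phiRot r r v)) (diag0 (compl r v) ∸ d)

PsiPC : ℕ → ℕ → GrIdx → FlIdx
PsiPC m r (grIdx l u v e) =
  flIdx (wOf (m + r) l) (wOf (m + r) u)
        (comp (comp (wOf (m + r) v) (w0P (m + r) m)) (w0P' (m + r) m e))
        (degPeak (m + r) m e)

GammaT : ℕ → FlIdx → FlIdx
GammaT n (flIdx u v w d) = flIdx (conj n u) (conj n v) (conj n w) (reverse d)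

InSkew : List ℕ → List ℕ → ℕ → ℕ → Set
InSkew nu rho i j = (1 ≤ i) × (row nu i < j) × (j ≤ row rho i)

data Adj : ℕ × ℕ → ℕ × ℕ → Set where
  up    : ∀ {i j} → Adj (i , j) (suc i , j)
  down′ : ∀ {i j} → Adj (suc i , j) (i , j)
  right : ∀ {i j} → Adj (i , j) (i , suc j)
  left  : ∀ {i j} → Adj (i , suc j) (i , j)

data Reach (nu rho : List ℕ) : ℕ × ℕ → ℕ × ℕ → Set where
  here : ∀ {i j} → Reach nu rho (i , j) (i , j)
  step : ∀ {i j i′ j′ i″ j″} → Adj (i , j) (i′ , j′) → InSkew nu rho i′ j′ →
         Reach nu rho (i′ , j′) (i″ , j″) → Reach nu rho (i , j) (i″ , j″)

Connected : List ℕ → List ℕ → Set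
Connected nu rho = ∀ i j i′ j′ → InSkew nu rho i j → InSkew nu rho i′ j′ →
                   Reach nu rho (i , j) (i′ , j′)

No2x2 : List ℕ → List ℕ → Set
No2x2 nu rho = ∀ i j → ¬ (InSkew nu rho i j × InSkew nu rho (suc i) j ×
                          InSkew nu rho i (suc j) × InSkew nu rho (suc i) (suc j))

-- the head (southeasternmost cell: lowest row, rightmost column) lies in column c
HeadInColumn : ℕ → List ℕ → List ℕ → Set
HeadInColumn c nu rho = Σ ℕ λ i → InSkew nu rho i c ×
  (∀ i′ j′ → InSkew nu rho i′ j′ → (i ≤ i′) × (j′ ≤ c))

AddHook : ℕ → ℕ → List ℕ → List ℕ → Set
AddHook n c nu rho =
  Decreasing rho × (∀ i → row nu i ≤ row rho i) × (sum rho ≡ sum nu + n) ×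
  Connected nu rho × No2x2 nu rho × HeadInColumn c nu rho

-- AddHooks n c ν d ρ : ρ is obtained from ν by adding d n-rim hooks, all
-- heads in column c (so ρ = ν ⊕ d when c = r)
data AddHooks (n c : ℕ) (nu : List ℕ) : ℕ → List ℕ → Set where
  none : AddHooks n c nu 0 nu
  more : ∀ {d rho sigma} → AddHooks n c nu d rho → AddHook n c rho sigma →
         AddHooks n c nu (suc d) sigma

rowsFrom : List ℕ → ℕ → ℕ → List ℕ
rowsFrom rho a b = map (λ i → row rho (a + i)) (oneTo b)

-- s = diag₀((ν⊕d)^{∨_r}); part of ρ inside R_r = its first m rows
sOf : ℕ → ℕ → List ℕ → ℕ
sOf m r rho = diag0 (compl r (rowsFrom rho 0 m))

PhiFl : ℕ → ℕ → KIdx → FlIdx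
PhiFl m r (kIdx l u rho) =
  flIdx (phiJ n r l) (phiJ n r u)
        (comp (phiJ n (r ∸ s) eta2) (phiJ n (r + s) eta1))
        (degPeak n r s)
  where
    n = m + r
    s = sOf m r rho
    eta1 = rowsFrom rho 0 (m ∸ s)
    eta2 = rowsFrom rho (m ∸ s) (m + s)  -- remaining rows, as m + s rows of R_{r-s}

{-# OPTIONS --safe #-}

-- Read every index off the bit string of ν.  Adding a hook with head in column r
-- moves the last remaining one of the string n places to the left, so ν ⊕ d is
-- obtained by moving the last d ones.  Write the string as b x y with |b| = r and
-- with exactly d ones in y.  Then D = diag₀(ν^∨) is the number of zeros of b, which
-- equals the number of ones of x y, so x contains t = D − d ones, and
--   φʳ(ν) has string x y b,
--   η¹ has string 1^{r−t} x 0^{|y|} 1^t  and  η² has string 0^{|x|} y b.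
-- A Grassmannian permutation lists the positions of the zeros and of the ones of its
-- string.  Both permutations in the theorem turn out to list the ones of y b, the
-- ones of x, the last t zeros of x y b and then its other zeros.

module Submission where

open import Defs
open import Data.Bool using (Bool; true; false; not; if_then_else_; _∨_)
open import Data.Bool.Properties using (not-involutive)
open import Data.Empty using (⊥-elim)
open import Data.List using (List; []; _∷_; _++_; _∷ʳ_; map; reverse; replicate; length; applyUpTo; zipWith; filterᵇ; take; drop)
open import Data.List.Properties
open import Data.List.Relation.Unary.All as All using (All; []; _∷_)
open import Data.List.Relation.Unary.All.Properties using (++⁺)
open import Data.Nat using (ℕ; zero; suc; pred; _+_; _*_; _∸_; _≤_; _<_; _≡ᵇ_; _≤ᵇ_; z≤n; s≤s; _≤?_; _<?_; ∣_-_∣)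
open import Data.Nat.ListAction using (sum)
open import Data.Nat.Properties
open import Data.Nat.Solver using (module +-*-Solver)
open import Data.Product using (_×_; _,_; proj₁; proj₂; ∃-syntax)
open import Data.Sum using (_⊎_; inj₁; inj₂)
open import Function using (_∘_)
open import Relation.Binary.Definitions using (tri<; tri≈; tri>)
open import Relation.Binary.PropositionalEquality
open import Relation.Nullary using (¬_; yes; no; contradiction)
open import Tactic.MonoidSolver using (solve)

open +-*-Solver using (_:+_; _:=_; con) renaming (solve to solveℕ)

-- A hook whose head lies in column `r` starts in the lowest row shorter than `r`. Connectedness and
-- the absence of 2×2 squares make each further row of the hook end one column beyond the old row
-- below it. So the shape is forced until the hook stops, and the size `m + r` makes it stop exactly
-- `m` rows above the head, in column 1. There is then one more full row, while the other `m` rows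
-- move up by one and grow by one: on strings, `M 1 0^a` turns into `1 M 0^(a+1)`, where `a` counts
-- the full rows. This is the move by `n` places. As ν ⊕ d outgrows the rectangle, its string has no
-- fixed length, and leading zeros of a string are empty rows; therefore shapes are compared by
-- `_≋_`. The two permutations agree because the four pieces of the string of η¹ have the lengths of
-- the four blocks of φ(η²): composing them selects whole blocks, except that `x` picks its own ones
-- and zeros out of an increasing run.

row-++ˡ : ∀ xs ys {i} → i < length xs → row (xs ++ ys) (suc i) ≡ row xs (suc i)
row-++ˡ (x ∷ xs) ys {zero}  _         = refl
row-++ˡ (x ∷ xs) ys {suc i} (s≤s i<n) = row-++ˡ xs ys i<n

row-++ʳ : ∀ xs ys i → row (xs ++ ys) (suc (length xs + i)) ≡ row ys (suc i)
row-++ʳ []       ys i = refl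
row-++ʳ (x ∷ xs) ys i = row-++ʳ xs ys i

row-beyond : ∀ xs {i} → length xs ≤ i → row xs (suc i) ≡ 0
row-beyond []       _                 = refl
row-beyond (x ∷ xs) {suc i} (s≤s n≤i) = row-beyond xs n≤i

row-replicate : ∀ a {c i} → i < a → row (replicate a c) (suc i) ≡ c
row-replicate (suc a) {i = zero}  _         = refl
row-replicate (suc a) {i = suc i} (s≤s i<a) = row-replicate a i<a

row-replicate-++ˡ : ∀ a c ys {i} → i < a → row (replicate a c ++ ys) (suc i) ≡ c
row-replicate-++ˡ a c ys i<a =
  trans (row-++ˡ (replicate a c) ys (subst (_ <_) (sym (length-replicate a)) i<a)) (row-replicate a i<a)

row-replicate-++ʳ : ∀ a c ys i → row (replicate a c ++ ys) (suc (a + i)) ≡ row ys (suc i)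
row-replicate-++ʳ zero    c ys i = refl
row-replicate-++ʳ (suc a) c ys i = row-replicate-++ʳ a c ys i

row-map-suc : ∀ xs {i} → i < length xs → row (map suc xs) (suc i) ≡ suc (row xs (suc i))
row-map-suc (x ∷ xs) {zero}  _         = refl
row-map-suc (x ∷ xs) {suc i} (s≤s i<n) = row-map-suc xs i<n

row-++-zeros : ∀ xs q i → row (xs ++ replicate q 0) (suc i) ≡ row xs (suc i)
row-++-zeros []       zero    i       = refl
row-++-zeros []       (suc q) zero    = refl
row-++-zeros []       (suc q) (suc i) = row-++-zeros [] q i
row-++-zeros (x ∷ xs) q       zero    = refl
row-++-zeros (x ∷ xs) q       (suc i) = row-++-zeros xs q i

row-decreasing : ∀ xs → Decreasing xs → ∀ i → row xs (suc (suc i)) ≤ row xs (suc i)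
row-decreasing []           _          i       = z≤n
row-decreasing (x ∷ [])     _          zero    = z≤n
row-decreasing (x ∷ [])     _          (suc i) = z≤n
row-decreasing (x ∷ y ∷ xs) (y≤x , _)  zero    = y≤x
row-decreasing (x ∷ y ∷ xs) (_ , dec)  (suc i) = row-decreasing (y ∷ xs) dec i

antitone-+ : ∀ {f : ℕ → ℕ} → (∀ i → f (suc i) ≤ f i) → ∀ i j → f (i + j) ≤ f i
antitone-+ {f} f↓ i zero    = ≤-reflexive (cong f (+-identityʳ i))
antitone-+ {f} f↓ i (suc j) = ≤-trans (≤-reflexive (cong f (+-suc i j))) (≤-trans (f↓ (i + j)) (antitone-+ f↓ i j))

antitone-≤ : ∀ {f : ℕ → ℕ} → (∀ i → f (suc i) ≤ f i) → ∀ {i j} → i ≤ j → f j ≤ f i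
antitone-≤ {f} f↓ {i} i≤j = subst (λ k → f k ≤ f i) (m+[n∸m]≡n i≤j) (antitone-+ f↓ i _)

-- Equality of partitions up to trailing zeros.

_≋_ : List ℕ → List ℕ → Set
xs ≋ ys = ∀ i → row xs (suc i) ≡ row ys (suc i)

<⊎+ : ∀ a i → i < a ⊎ ∃[ j ] i ≡ a + j
<⊎+ a i with i <? a
... | yes i<a = inj₁ i<a
... | no  i≮a = inj₂ (i ∸ a , sym (m+[n∸m]≡n (≮⇒≥ i≮a)))

-- Partial sums

partialSum : (ℕ → ℕ) → ℕ → ℕ
partialSum f zero    = 0
partialSum f (suc k) = partialSum f k + f k

partialSum-cong : ∀ {f g} k → (∀ {i} → i < k → f i ≡ g i) → partialSum f k ≡ partialSum g k
partialSum-cong zero    f≈g = refl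
partialSum-cong (suc k) f≈g = cong₂ _+_ (partialSum-cong k (λ i<k → f≈g (m<n⇒m<1+n i<k))) (f≈g ≤-refl)

partialSum-+ : ∀ f k p → partialSum f (k + p) ≡ partialSum f k + partialSum (λ i → f (k + i)) p
partialSum-+ f k zero    = trans (cong (partialSum f) (+-identityʳ k)) (sym (+-identityʳ _))
partialSum-+ f k (suc p) = begin
  partialSum f (k + suc p)               ≡⟨ cong (partialSum f) (+-suc k p) ⟩
  partialSum f (k + p) + f (k + p)       ≡⟨ cong (_+ f (k + p)) (partialSum-+ f k p) ⟩
  partialSum f k + partialSum (λ i → f (k + i)) p + f (k + p) ≡⟨ +-assoc (partialSum f k) _ _ ⟩
  partialSum f k + (partialSum (λ i → f (k + i)) p + f (k + p)) ∎
  where open ≡-Reasoning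

partialSum-zero : ∀ {f} k → (∀ i → f i ≡ 0) → partialSum f k ≡ 0
partialSum-zero zero    f≈0 = refl
partialSum-zero (suc k) f≈0 rewrite f≈0 k = trans (+-identityʳ _) (partialSum-zero k f≈0)

partialSum-head : ∀ f p → f 0 ≤ partialSum f (suc p)
partialSum-head f zero    = ≤-refl
partialSum-head f (suc p) = ≤-trans (partialSum-head f p) (m≤m+n _ _)

sum≡partialSum : ∀ xs {k} → length xs ≤ k → sum xs ≡ partialSum (λ i → row xs (suc i)) k
sum≡partialSum []       {k}     _         = sym (partialSum-zero k (λ _ → refl))
sum≡partialSum (x ∷ xs) {suc k} (s≤s n≤k) =
  trans (cong (x +_) (sum≡partialSum xs n≤k)) (sym (partialSum-+ (λ i → row (x ∷ xs) (suc i)) 1 k))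

-- Rim hooks

-- A path changes its row by at most one, so its first passage from row `k` to row `suc k` is a
-- vertical step between two cells of one column. Applied to paths that start at the head.
crossing : ∀ {ν ρ i j i″ j″ k} → Reach ν ρ (i , j) (i″ , j″) → InSkew ν ρ i j →
           i ≤ k → k < i″ → ∃[ c ] InSkew ν ρ k c × InSkew ν ρ (suc k) c
crossing here _ i≤k k<i = contradiction i≤k (<⇒≱ k<i)
crossing {i = i} {j = j} {k = k} (step up s rest) s₀ i≤k k<i″ with suc i ≤? k
... | yes i<k = crossing rest s i<k k<i″
... | no  i≮k with ≤-antisym i≤k (≤-pred (≰⇒> i≮k))
...   | refl = j , s₀ , s
crossing (step down′ s rest) _ i≤k k<i″ = crossing rest s (≤-trans (n≤1+n _) i≤k) k<i″
crossing (step right s rest) _ i≤k k<i″ = crossing rest s i≤k k<i″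
crossing (step left s rest)  _ i≤k k<i″ = crossing rest s i≤k k<i″

-- Rows are indexed from 0 here: f and h are the rows of ρ and σ.
module RimHook {m r a : ℕ} {ρ σ : List ℕ}
  (ρ↓ : Decreasing ρ)
  (hook : AddHook (m + r) r ρ σ)
  (full : ∀ {i} → i < a → row ρ (suc i) ≡ r)
  (notFull : row ρ (suc a) < r)
  (top : row ρ (suc (a + m)) ≡ 0)
  where

  f h : ℕ → ℕ
  f i = row ρ (suc i)
  h i = row σ (suc i)

  f↓ : ∀ i → f (suc i) ≤ f i
  f↓ = row-decreasing ρ ρ↓

  h↓ : ∀ i → h (suc i) ≤ h i
  h↓ = row-decreasing σ (proj₁ hook)

  f≤h : ∀ i → f i ≤ h i
  f≤h i = proj₁ (proj₂ hook) (suc i)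

  connected : Connected ρ σ
  connected = proj₁ (proj₂ (proj₂ (proj₂ hook)))

  no2x2 : No2x2 ρ σ
  no2x2 = proj₁ (proj₂ (proj₂ (proj₂ (proj₂ hook))))

  head-row : ∃[ i ] InSkew ρ σ i r × (∀ i′ j′ → InSkew ρ σ i′ j′ → (i ≤ i′) × (j′ ≤ r))
  head-row = proj₂ (proj₂ (proj₂ (proj₂ (proj₂ hook))))

  cell : ∀ {i} → f i < h i → InSkew ρ σ (suc i) (h i)
  cell f<h = s≤s z≤n , f<h , ≤-refl

  -- The head needs a row shorter than `r`, so it is not below row `a`. Were it higher, the cell of
  -- row `a` in column `r` would be new as well, since the rows of σ weakly decrease, and it would
  -- lie below the head.
  head-at : InSkew ρ σ (suc a) r × (∀ i′ j′ → InSkew ρ σ i′ j′ → (suc a ≤ i′) × (j′ ≤ r))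
  head-at with head-row
  ... | suc i , inSkew@(1≤i , f<r , r≤h) , least with <-cmp i a
  ...   | tri≈ _ refl _ = inSkew , least
  ...   | tri< i<a _ _ = contradiction (full i<a) (<⇒≢ f<r)
  ...   | tri> _ _ a<i = contradiction
            (proj₁ (least (suc a) r (s≤s z≤n , notFull , ≤-trans r≤h (antitone-≤ h↓ (<⇒≤ a<i)))))
            (<⇒≱ (s≤s a<i))

  h-below : ∀ {i} → i < a → h i ≡ f i
  h-below {i} i<a with f i <? h i
  ... | yes f<h = contradiction (proj₁ (proj₂ head-at _ _ (cell f<h))) (<⇒≱ (s≤s i<a))
  ... | no  f≮h = ≤-antisym (≮⇒≥ f≮h) (f≤h i)

  h-head : h a ≡ r
  h-head = ≤-antisym (proj₂ (proj₂ head-at _ _ (cell (<-≤-trans notFull r≤h)))) r≤h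
    where r≤h = proj₂ (proj₂ (proj₁ head-at))

  -- In h (suc k) ≡ suc (f k), connectedness gives ≥ and the absence of 2×2 squares gives ≤.
  crossed : ∀ {k l} → a ≤ k → k < l → f l < h l → (f k < h k) × (h (suc k) ≡ suc (f k)) × (f (suc k) < h (suc k))
  crossed {k} {l} a≤k k<l f<h
    with crossing (connected _ _ _ _ (proj₁ head-at) (cell f<h)) (proj₁ head-at) (s≤s a≤k) (s≤s k<l)
  ... | c , (_ , fk<c , c≤hk) , (_ , fk′<c , c≤hk′) =
    <-≤-trans fk<c c≤hk , ≤-antisym (≮⇒≥ square) (≤-trans fk<c c≤hk′) , <-≤-trans fk′<c c≤hk′
    where
    square : ¬ (suc (f k) < h (suc k))
    square 2+f≤h = no2x2 (suc k) (suc (f k))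
      ( (s≤s z≤n , ≤-refl , ≤-trans (<⇒≤ 2+f≤h) (h↓ k))
      , (s≤s z≤n , s≤s (f↓ k) , <⇒≤ 2+f≤h)
      , (s≤s z≤n , n≤1+n _ , ≤-trans 2+f≤h (h↓ k))
      , (s≤s z≤n , s≤s (≤-trans (f↓ k) (n≤1+n _)) , 2+f≤h) )

  -- Telescoping `h a ≡ r` and `h (suc k) ≡ suc (f k)`. Up to row `a + j` the hook has
  -- `r + j - f (a + j)` cells, the size of a ribbon with `j + 1` rows over the columns from
  -- `f (a + j) + 1` to `r`; the subtracted term stands on the left.
  prefix-size : ∀ j → f (a + j) < h (a + j) →
    partialSum h (suc (a + j)) + f (a + j) ≡ partialSum f (suc (a + j)) + (r + j)
  prefix-size zero    _ rewrite +-identityʳ a | +-identityʳ r | h-head | partialSum-cong {h} {f} a h-below =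
    solveℕ 3 (λ s x y → (s :+ x) :+ y := (s :+ y) :+ x) refl (partialSum f a) r (f a)
  prefix-size (suc j) f<h rewrite +-suc a j with crossed (m≤m+n a j) ≤-refl f<h
  ... | fk<hk , hk′≡ , _ = begin
    partialSum h (suc k) + h (suc k) + f (suc k)   ≡⟨ cong (λ z → partialSum h (suc k) + z + f (suc k)) hk′≡ ⟩
    partialSum h (suc k) + suc (f k) + f (suc k)
      ≡⟨ solveℕ 3 (λ s x y → s :+ (con 1 :+ x) :+ y := (s :+ x) :+ (con 1 :+ y)) refl (partialSum h (suc k)) (f k) _ ⟩
    (partialSum h (suc k) + f k) + suc (f (suc k)) ≡⟨ cong (_+ suc (f (suc k))) (prefix-size j fk<hk) ⟩
    partialSum f (suc k) + (r + j) + suc (f (suc k))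
      ≡⟨ solveℕ 4 (λ s x y z → s :+ (x :+ y) :+ (con 1 :+ z) := (s :+ z) :+ (x :+ (con 1 :+ y))) refl (partialSum f (suc k)) r j _ ⟩
    partialSum f (suc k) + f (suc k) + (r + suc j) ∎
    where
    open ≡-Reasoning
    k = a + j

  -- The size equation of the hook, split at row `k`. The tail is long enough to exhaust both lists
  -- and is never empty, so that its first summand can be bounded by it.
  total-size : ∀ k → ∃[ p ]
    partialSum h k + partialSum (λ i → h (k + i)) (suc p) ≡ partialSum f k + partialSum (λ i → f (k + i)) (suc p) + (m + r)
  total-size k = p , (begin
    partialSum h k + partialSum (λ i → h (k + i)) (suc p) ≡⟨ sym (partialSum-+ h k (suc p)) ⟩
    partialSum h (k + suc p)       ≡⟨ sym (sum≡partialSum σ (≤-trans (m≤n+m (length σ) (length ρ)) p≤)) ⟩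
    sum σ                          ≡⟨ proj₁ (proj₂ (proj₂ hook)) ⟩
    sum ρ + (m + r)                ≡⟨ cong (_+ (m + r)) (sum≡partialSum ρ (≤-trans (m≤m+n (length ρ) (length σ)) p≤)) ⟩
    partialSum f (k + suc p) + (m + r) ≡⟨ cong (_+ (m + r)) (partialSum-+ f k (suc p)) ⟩
    partialSum f k + partialSum (λ i → f (k + i)) (suc p) + (m + r) ∎)
    where
    open ≡-Reasoning
    p = length ρ + length σ
    p≤ : p ≤ k + suc p
    p≤ = ≤-trans (n≤1+n p) (m≤n+m (suc p) k)

  -- If the hook stopped at row `a + j` with `j < m`, connectedness would leave it no cell higher
  -- up, and its size would be `r + j - f (a + j)`, which is less than `m + r`.
  occupied : ∀ j → j ≤ m → f (a + j) < h (a + j)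
  occupied zero    _ rewrite +-identityʳ a = <-≤-trans notFull (≤-reflexive (sym h-head))
  occupied (suc j) j<m with f (a + suc j) <? h (a + suc j)
  ... | yes f<h = f<h
  ... | no  f≮h with total-size (suc (a + j))
  ...   | p , total = ⊥-elim (<⇒≢ (≤-trans j<m (m≤m+n m (f k))) (sym m+f≡j))
    where
    open ≡-Reasoning
    k = a + j
    tail : ∀ i → h (suc k + i) ≡ f (suc k + i)
    tail i with f (suc k + i) <? h (suc k + i)
    ... | no  f≮h′ = ≤-antisym (≮⇒≥ f≮h′) (f≤h _)
    ... | yes f<h′ = contradiction
      (subst (λ z → f z < h z) (sym (+-suc a j)) (proj₂ (proj₂ (crossed (m≤m+n a j) (s≤s (m≤m+n k i)) f<h′)))) f≮h
    T = partialSum (λ i → f (suc k + i)) (suc p)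
    total′ : partialSum h (suc k) ≡ partialSum f (suc k) + (m + r)
    total′ = +-cancelʳ-≡ T _ _ (begin
      partialSum h (suc k) + T ≡⟨ cong (partialSum h (suc k) +_) (sym (partialSum-cong (suc p) (λ {i} _ → tail i))) ⟩
      _                        ≡⟨ total ⟩
      partialSum f (suc k) + T + (m + r)
        ≡⟨ solveℕ 3 (λ x y z → x :+ y :+ z := x :+ z :+ y) refl (partialSum f (suc k)) T (m + r) ⟩
      partialSum f (suc k) + (m + r) + T ∎)
    m+f≡j : m + f k ≡ j
    m+f≡j = +-cancelˡ-≡ (partialSum f (suc k) + r) _ _ (begin
      partialSum f (suc k) + r + (m + f k)
        ≡⟨ solveℕ 4 (λ s x y z → s :+ x :+ (y :+ z) := s :+ (y :+ x) :+ z) refl (partialSum f (suc k)) r m (f k) ⟩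
      partialSum f (suc k) + (m + r) + f k ≡⟨ cong (_+ f k) (sym total′) ⟩
      partialSum h (suc k) + f k ≡⟨ prefix-size j (occupied j (<⇒≤ j<m)) ⟩
      partialSum f (suc k) + (r + j) ≡⟨ sym (+-assoc (partialSum f (suc k)) r j) ⟩
      partialSum f (suc k) + r + j ∎)

  h-hook : ∀ {j} → j < m → h (suc (a + j)) ≡ suc (f (a + j))
  h-hook {j} j<m = proj₁ (proj₂ (crossed (m≤m+n a j) ≤-refl
    (subst (λ z → f z < h z) (+-suc a j) (occupied (suc j) j<m))))

  f-above : ∀ i → f (suc (a + m) + i) ≡ 0
  f-above i = n≤0⇒n≡0 (≤-trans (antitone-≤ f↓ (≤-trans (n≤1+n _) (m≤m+n (suc (a + m)) i))) (≤-reflexive top))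

  -- Row `a + m` of ρ is empty, so the cells up to this row already number `r + m`, the whole hook.
  h-above : ∀ i → h (suc (a + m) + i) ≡ 0
  h-above i = n≤0⇒n≡0 (≤-trans (antitone-+ h↓ k i) (subst (h k ≤_) tail≡0 h-k≤))
    where
    open ≡-Reasoning
    k = suc (a + m)
    p = proj₁ (total-size k)
    h-k≤ : h k ≤ partialSum (λ i → h (k + i)) (suc p)
    h-k≤ = subst (λ z → h z ≤ partialSum (λ i → h (k + i)) (suc p)) (+-identityʳ k) (partialSum-head (λ i → h (k + i)) p)
    size : partialSum h k ≡ partialSum f k + (m + r)
    size = begin
      partialSum h k ≡⟨ sym (+-identityʳ _) ⟩
      partialSum h k + 0 ≡⟨ cong (partialSum h k +_) (sym top) ⟩
      partialSum h k + f (a + m) ≡⟨ prefix-size m (occupied m ≤-refl) ⟩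
      partialSum f k + (r + m) ≡⟨ cong (partialSum f k +_) (+-comm r m) ⟩
      partialSum f k + (m + r) ∎
    tail≡0 : partialSum (λ i → h (k + i)) (suc p) ≡ 0
    tail≡0 = +-cancelˡ-≡ (partialSum h k) _ _ (begin
      partialSum h k + partialSum (λ i → h (k + i)) (suc p) ≡⟨ proj₂ (total-size k) ⟩
      partialSum f k + partialSum (λ i → f (k + i)) (suc p) + (m + r)
        ≡⟨ cong (λ z → partialSum f k + z + (m + r)) (partialSum-zero (suc p) f-above) ⟩
      partialSum f k + 0 + (m + r) ≡⟨ cong (_+ (m + r)) (+-identityʳ (partialSum f k)) ⟩
      partialSum f k + (m + r) ≡⟨ sym size ⟩
      partialSum h k ≡⟨ sym (+-identityʳ _) ⟩
      partialSum h k + 0 ∎)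

row-All-< : ∀ {r xs} → 0 < r → All (_< r) xs → ∀ i → row xs i < r
row-All-< 0<r _          zero          = 0<r
row-All-< 0<r []         (suc i)       = 0<r
row-All-< 0<r (x<r ∷ _)  (suc zero)    = x<r
row-All-< 0<r (_ ∷ xs<r) (suc (suc i)) = row-All-< 0<r xs<r (suc i)

-- Row `a`, the first of `N`, is the lowest one that is not full. The hook fills it, and every row
-- of `N` reappears one row higher and one cell longer.
addHook-shape : ∀ {m r} a {N ρ σ} → 0 < r → Decreasing ρ → length N ≡ m → All (_< r) N →
  ρ ≋ (replicate a r ++ N) → AddHook (m + r) r ρ σ → σ ≋ (replicate (suc a) r ++ map suc N)
addHook-shape {m} {r} a {N} {ρ} {σ} 0<r ρ↓ refl N<r ρ≋ hook i = shape
  where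
  ρ-low : ∀ {i} → i < a → row ρ (suc i) ≡ r
  ρ-low i<a = trans (ρ≋ _) (row-replicate-++ˡ a r N i<a)
  ρ-high : ∀ j → row ρ (suc (a + j)) ≡ row N (suc j)
  ρ-high j = trans (ρ≋ _) (row-replicate-++ʳ a r N j)
  open RimHook {m} {r} {a} ρ↓ hook ρ-low
    (subst (λ z → row ρ (suc z) < r) (+-identityʳ a) (subst (_< r) (sym (ρ-high 0)) (row-All-< 0<r N<r 1)))
    (trans (ρ-high m) (row-beyond N ≤-refl))
  shape : h i ≡ row (replicate (suc a) r ++ map suc N) (suc i)
  shape with <⊎+ (suc a) i
  ... | inj₁ i<1+a = trans low (sym (row-replicate-++ˡ (suc a) r (map suc N) i<1+a))
    where
    low : h i ≡ r
    low with m≤n⇒m<n∨m≡n (≤-pred i<1+a)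
    ... | inj₁ i<a  = trans (h-below i<a) (ρ-low i<a)
    ... | inj₂ refl = h-head
  ... | inj₂ (j , refl) = trans high (sym (row-replicate-++ʳ (suc a) r (map suc N) j))
    where
    high : h (suc (a + j)) ≡ row (map suc N) (suc j)
    high with <⊎+ m j
    ... | inj₁ j<m = trans (h-hook j<m) (trans (cong suc (ρ-high j)) (sym (row-map-suc N j<m)))
    ... | inj₂ (l , refl) = trans (trans (cong (λ z → h (suc z)) (sym (+-assoc a m l))) (h-above l))
      (sym (row-beyond (map suc N) (≤-trans (≤-reflexive (length-map suc N)) (m≤m+n m l))))

addHooks-decreasing : ∀ {n c ν d ρ} → Decreasing ν → AddHooks n c ν d ρ → Decreasing ρ
addHooks-decreasing ν↓ none              = ν↓
addHooks-decreasing ν↓ (more _ (σ↓ , _)) = σ↓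

-- One-line notation: ranges, decreasing blocks, composition.

range : ℕ → ℕ → List ℕ
range k zero    = []
range k (suc n) = k ∷ range (suc k) n

oneTo≡range : ∀ n → oneTo n ≡ range 1 n
oneTo≡range n = trans (map-upTo suc n) (go 1 n)
  where
  applyUpTo-cong : ∀ {f g : ℕ → ℕ} n → (∀ i → f i ≡ g i) → applyUpTo f n ≡ applyUpTo g n
  applyUpTo-cong zero    f≈g = refl
  applyUpTo-cong (suc n) f≈g = cong₂ _∷_ (f≈g 0) (applyUpTo-cong n (f≈g ∘ suc))
  go : ∀ k n → applyUpTo (k +_) n ≡ range k n
  go k zero    = refl
  go k (suc n) = cong₂ _∷_ (+-identityʳ k) (trans (applyUpTo-cong n (+-suc k)) (go (suc k) n))

range-∷ʳ : ∀ k n → range k (suc n) ≡ range k n ∷ʳ (k + n)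
range-∷ʳ k zero    = cong (_∷ []) (sym (+-identityʳ k))
range-∷ʳ k (suc n) = cong (k ∷_) (trans (range-∷ʳ (suc k) n) (cong (range (suc k) n ∷ʳ_) (sym (+-suc k n))))

map-+-range : ∀ a k n → map (a +_) (range k n) ≡ range (a + k) n
map-+-range a k zero    = refl
map-+-range a k (suc n) = cong (a + k ∷_) (trans (map-+-range a (suc k) n) (cong (λ z → range z n) (+-suc a k)))

down≡range : ∀ a c → down a (a + c) ≡ reverse (range (suc a) c)
down≡range a c rewrite m+n∸m≡n a c | oneTo≡range c | map-+-range a 1 c | +-comm a 1 = refl

w0≡range : ∀ n → w0 n ≡ reverse (range 1 n)
w0≡range = down≡range 0

map-row-range : ∀ xs ys zs {a c} → length xs ≡ a → length ys ≡ c →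
  map (row (xs ++ ys ++ zs)) (range (suc a) c) ≡ ys
map-row-range xs [] zs refl refl = refl
map-row-range xs (y ∷ ys) zs refl refl = cong₂ _∷_
  (trans (cong (row (xs ++ y ∷ ys ++ zs) ∘ suc) (sym (+-identityʳ (length xs)))) (row-++ʳ xs _ 0))
  (trans (cong (λ l → map (row l) (range (suc (suc (length xs))) (length ys))) (sym (++-assoc xs (y ∷ []) (ys ++ zs))))
         (map-row-range (xs ∷ʳ y) ys zs (trans (length-++ xs) (+-comm (length xs) 1)) refl))

-- `w0`, `w0P` and `w0P'` are all concatenations of `down` blocks, so this computation evaluates
-- right multiplication by each of them.
comp-down : ∀ xs ys zs {a c} → length xs ≡ a → length ys ≡ c →
  comp (xs ++ ys ++ zs) (down a (a + c)) ≡ reverse ys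
comp-down xs ys zs {a} {c} p q = begin
  map (row l) (down a (a + c))             ≡⟨ cong (map (row l)) (down≡range a c) ⟩
  map (row l) (reverse (range (suc a) c))  ≡⟨ reverse-map (row l) (range (suc a) c) ⟩
  reverse (map (row l) (range (suc a) c))  ≡⟨ cong reverse (map-row-range xs ys zs p q) ⟩
  reverse ys ∎
  where
  open ≡-Reasoning
  l = xs ++ ys ++ zs

≋⇒row≡ : ∀ {xs ys} → xs ≋ ys → ∀ i → row xs i ≡ row ys i
≋⇒row≡ p zero    = refl
≋⇒row≡ p (suc i) = p i

rowsFrom-≋ : ∀ {ρ} xs ys zs {a c} → ρ ≋ (xs ++ ys ++ zs) → length xs ≡ a → length ys ≡ c → rowsFrom ρ a c ≡ ys
rowsFrom-≋ {ρ} xs ys zs {a} {c} ρ≋ p q = begin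
  map (λ i → row ρ (a + i)) (oneTo c)    ≡⟨ map-cong (λ i → ≋⇒row≡ {ρ} ρ≋ (a + i)) (oneTo c) ⟩
  map (λ i → row l (a + i)) (oneTo c)    ≡⟨ map-∘ (oneTo c) ⟩
  map (row l) (map (a +_) (oneTo c))     ≡⟨ cong (map (row l) ∘ map (a +_)) (oneTo≡range c) ⟩
  map (row l) (map (a +_) (range 1 c))   ≡⟨ cong (map (row l)) (trans (map-+-range a 1 c) (cong (λ z → range z c) (+-comm a 1))) ⟩
  map (row l) (range (suc a) c)          ≡⟨ map-row-range xs ys zs p q ⟩
  ys ∎
  where
  open ≡-Reasoning
  l = xs ++ ys ++ zs

row-map-row : ∀ u v i → row (map (row u) v) i ≡ row u (row v i)
row-map-row u v       zero          = refl
row-map-row u []      (suc i)       = refl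
row-map-row u (x ∷ v) (suc zero)    = refl
row-map-row u (x ∷ v) (suc (suc i)) = row-map-row u v (suc i)

comp-assoc : ∀ u v w → comp u (comp v w) ≡ comp (comp u v) w
comp-assoc u v w = trans (sym (map-∘ w)) (map-cong (λ i → sym (row-map-row u v i)) w)

comp-w0 : ∀ w {n} → length w ≡ n → comp w (w0 n) ≡ reverse w
comp-w0 w {n} p = trans (cong (λ l → comp l (w0 n)) (sym (++-identityʳ w))) (comp-down [] w [] refl p)

row-w0 : ∀ n i → row (w0 n) (suc i) ≡ n ∸ i
row-w0 n i = trans (cong (λ l → row l (suc i)) (w0≡range n)) (go n i)
  where
  unfold : ∀ n → reverse (range 1 (suc n)) ≡ suc n ∷ reverse (range 1 n)
  unfold n = trans (cong reverse (range-∷ʳ 1 n)) (reverse-++ (range 1 n) (suc n ∷ []))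
  go : ∀ n i → row (reverse (range 1 n)) (suc i) ≡ n ∸ i
  go zero    zero    = refl
  go zero    (suc i) = refl
  go (suc n) zero    = cong (λ l → row l 1) (unfold n)
  go (suc n) (suc i) = trans (cong (λ l → row l (suc (suc i))) (unfold n)) (go n i)

reverse-replicate : ∀ {A : Set} n (x : A) → reverse (replicate n x) ≡ replicate n x
reverse-replicate zero    x = refl
reverse-replicate (suc n) x = trans (unfold-reverse x (replicate n x))
  (trans (cong (_∷ʳ x) (reverse-replicate n x)) (sym (replicate-∷ʳ n)))
  where
  replicate-∷ʳ : ∀ n → x ∷ replicate n x ≡ replicate n x ∷ʳ x
  replicate-∷ʳ zero    = refl
  replicate-∷ʳ (suc n) = cong (x ∷_) (replicate-∷ʳ n)

-- Bit strings

ones : ℕ → List Bool → List ℕ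
ones k []           = []
ones k (true  ∷ bs) = k ∷ ones (suc k) bs
ones k (false ∷ bs) = ones (suc k) bs

zeros : ℕ → List Bool → List ℕ
zeros k bs = ones k (map not bs)

#1 : List Bool → ℕ
#1 []           = 0
#1 (true  ∷ bs) = suc (#1 bs)
#1 (false ∷ bs) = #1 bs

#0 : List Bool → ℕ
#0 bs = #1 (map not bs)

length-ones : ∀ k bs → length (ones k bs) ≡ #1 bs
length-ones k []           = refl
length-ones k (true  ∷ bs) = cong suc (length-ones (suc k) bs)
length-ones k (false ∷ bs) = length-ones (suc k) bs

map-not-involutive : ∀ bs → map not (map not bs) ≡ bs
map-not-involutive bs = trans (sym (map-∘ bs)) (trans (map-cong not-involutive bs) (map-id bs))

ones-++ : ∀ k as bs → ones k (as ++ bs) ≡ ones k as ++ ones (k + length as) bs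
ones-++ k []           bs = cong (λ z → ones z bs) (sym (+-identityʳ k))
ones-++ k (true  ∷ as) bs = cong (k ∷_) (trans (ones-++ (suc k) as bs) (cong (λ z → ones (suc k) as ++ ones z bs) (sym (+-suc k (length as)))))
ones-++ k (false ∷ as) bs = trans (ones-++ (suc k) as bs) (cong (λ z → ones (suc k) as ++ ones z bs) (sym (+-suc k (length as))))

zeros-++ : ∀ k as bs → zeros k (as ++ bs) ≡ zeros k as ++ zeros (k + length as) bs
zeros-++ k as bs = trans (cong (ones k) (map-++ not as bs))
  (trans (ones-++ k (map not as) (map not bs))
         (cong (λ z → zeros k as ++ ones (k + z) (map not bs)) (length-map not as)))

#1-++ : ∀ as bs → #1 (as ++ bs) ≡ #1 as + #1 bs
#1-++ []           bs = refl
#1-++ (true  ∷ as) bs = cong suc (#1-++ as bs)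
#1-++ (false ∷ as) bs = #1-++ as bs

#0-++ : ∀ as bs → #0 (as ++ bs) ≡ #0 as + #0 bs
#0-++ as bs = trans (cong #1 (map-++ not as bs)) (#1-++ (map not as) (map not bs))

#0+#1 : ∀ bs → #0 bs + #1 bs ≡ length bs
#0+#1 []           = refl
#0+#1 (true  ∷ bs) = trans (+-suc (#0 bs) (#1 bs)) (cong suc (#0+#1 bs))
#0+#1 (false ∷ bs) = cong suc (#0+#1 bs)

ones-replicate-true : ∀ k n → ones k (replicate n true) ≡ range k n
ones-replicate-true k zero    = refl
ones-replicate-true k (suc n) = cong (k ∷_) (ones-replicate-true (suc k) n)

ones-replicate-false : ∀ k n → ones k (replicate n false) ≡ []
ones-replicate-false k zero    = refl
ones-replicate-false k (suc n) = ones-replicate-false (suc k) n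

zeros-replicate-false : ∀ k n → zeros k (replicate n false) ≡ range k n
zeros-replicate-false k n = trans (cong (ones k) (map-replicate not n false)) (ones-replicate-true k n)

zeros-replicate-true : ∀ k n → zeros k (replicate n true) ≡ []
zeros-replicate-true k n = trans (cong (ones k) (map-replicate not n true)) (ones-replicate-false k n)

length-range : ∀ k n → length (range k n) ≡ n
length-range k zero    = refl
length-range k (suc n) = cong suc (length-range (suc k) n)

-- Reading the string backwards turns position `p`, counted from `k`, into `k + length bs - p`,
-- counted from 1. For `k = 1` this reflection is left multiplication by `w0`.
ones-reverse : ∀ k bs → map ((k + length bs) ∸_) (ones k bs) ≡ reverse (ones 1 (reverse bs))
ones-reverse k []       = refl
ones-reverse k (b ∷ bs) = begin
  map ((k + suc (length bs)) ∸_) (ones k (b ∷ bs)) ≡⟨ head b ⟩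
  reverse (ones (suc (length bs)) (b ∷ [])) ++ map ((suc k + length bs) ∸_) (ones (suc k) bs)
    ≡⟨ cong (reverse (ones (suc (length bs)) (b ∷ [])) ++_) (ones-reverse (suc k) bs) ⟩
  reverse (ones (suc (length bs)) (b ∷ [])) ++ reverse (ones 1 (reverse bs))
    ≡⟨ sym (reverse-++ (ones 1 (reverse bs)) _) ⟩
  reverse (ones 1 (reverse bs) ++ ones (suc (length bs)) (b ∷ []))
    ≡⟨ cong (λ z → reverse (ones 1 (reverse bs) ++ ones (suc z) (b ∷ []))) (sym (length-reverse bs)) ⟩
  reverse (ones 1 (reverse bs) ++ ones (1 + length (reverse bs)) (b ∷ []))
    ≡⟨ cong reverse (sym (ones-++ 1 (reverse bs) (b ∷ []))) ⟩
  reverse (ones 1 (reverse bs ∷ʳ b)) ≡⟨ cong (reverse ∘ ones 1) (sym (unfold-reverse b bs)) ⟩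
  reverse (ones 1 (reverse (b ∷ bs))) ∎
  where
  open ≡-Reasoning
  shift : map ((k + suc (length bs)) ∸_) (ones (suc k) bs) ≡ map ((suc k + length bs) ∸_) (ones (suc k) bs)
  shift = cong (λ z → map (z ∸_) (ones (suc k) bs)) (+-suc k (length bs))
  head : ∀ b → map ((k + suc (length bs)) ∸_) (ones k (b ∷ bs)) ≡
    reverse (ones (suc (length bs)) (b ∷ [])) ++ map ((suc k + length bs) ∸_) (ones (suc k) bs)
  head true  = cong₂ _∷_ (m+n∸m≡n k (suc (length bs))) shift
  head false = shift

ones-positive : ∀ k bs → All (0 <_) (ones (suc k) bs)
ones-positive k []           = []
ones-positive k (true  ∷ bs) = s≤s z≤n ∷ ones-positive (suc k) bs
ones-positive k (false ∷ bs) = ones-positive (suc k) bs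

comp-w0-ones : ∀ bs {n} → length bs ≡ n → comp (w0 n) (ones 1 bs) ≡ reverse (ones 1 (reverse bs))
comp-w0-ones bs {n} refl = trans (map-cong-local (All.map reflect (ones-positive 0 bs))) (ones-reverse 1 bs)
  where
  reflect : ∀ {i} → 0 < i → row (w0 n) i ≡ suc n ∸ i
  reflect {suc i} _ = row-w0 n i

comp-w0-zeros : ∀ bs {n} → length bs ≡ n → comp (w0 n) (zeros 1 bs) ≡ reverse (zeros 1 (reverse bs))
comp-w0-zeros bs p = trans (comp-w0-ones (map not bs) (trans (length-map not bs) p))
  (cong (reverse ∘ ones 1) (sym (reverse-map not bs)))

-- Decoding bit strings

decodeAux-++ : ∀ c as bs → decodeAux c (as ++ bs) ≡ decodeAux c as ++ decodeAux (c + #1 as) bs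
decodeAux-++ c []           bs = cong (λ z → decodeAux z bs) (sym (+-identityʳ c))
decodeAux-++ c (true  ∷ as) bs rewrite +-suc c (#1 as) = decodeAux-++ (suc c) as bs
decodeAux-++ c (false ∷ as) bs = cong (c ∷_) (decodeAux-++ c as bs)

length-decodeAux : ∀ c bs → length (decodeAux c bs) ≡ #0 bs
length-decodeAux c []           = refl
length-decodeAux c (true  ∷ bs) = length-decodeAux (suc c) bs
length-decodeAux c (false ∷ bs) = cong suc (length-decodeAux c bs)

decodeAux-suc : ∀ c bs → decodeAux (suc c) bs ≡ map suc (decodeAux c bs)
decodeAux-suc c []           = refl
decodeAux-suc c (true  ∷ bs) = decodeAux-suc (suc c) bs
decodeAux-suc c (false ∷ bs) = cong (suc c ∷_) (decodeAux-suc c bs)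

decodeAux-≤ : ∀ c bs → All (_≤ c + #1 bs) (decodeAux c bs)
decodeAux-≤ c []           = []
decodeAux-≤ c (true  ∷ bs) rewrite +-suc c (#1 bs) = decodeAux-≤ (suc c) bs
decodeAux-≤ c (false ∷ bs) = m≤m+n c _ ∷ decodeAux-≤ c bs

decodeAux-replicate-false : ∀ c n → decodeAux c (replicate n false) ≡ replicate n c
decodeAux-replicate-false c zero    = refl
decodeAux-replicate-false c (suc n) = cong (c ∷_) (decodeAux-replicate-false c n)

decodeAux-replicate-true : ∀ c n bs → decodeAux c (replicate n true ++ bs) ≡ decodeAux (c + n) bs
decodeAux-replicate-true c zero    bs = cong (λ z → decodeAux z bs) (sym (+-identityʳ c))
decodeAux-replicate-true c (suc n) bs = trans (decodeAux-replicate-true (suc c) n bs) (cong (λ z → decodeAux z bs) (sym (+-suc c n)))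

compl-decode : ∀ j bs → compl j (decode bs) ≡ map (j ∸_) (decodeAux 0 bs)
compl-decode j bs = trans (cong reverse (reverse-map (j ∸_) (decodeAux 0 bs))) (reverse-involutive _)

-- A half turn of the rectangle exchanges the ones before a zero, which number its part, with the
-- ones after it.
compl-decode-reverse : ∀ j bs → #1 bs ≡ j → compl j (decode bs) ≡ decode (reverse bs)
compl-decode-reverse j bs refl = trans (compl-decode j bs) (go 0 bs)
  where
  open ≡-Reasoning
  snoc : ∀ b as → reverse (decodeAux 0 (as ++ b ∷ [])) ≡ reverse (decodeAux (#1 as) (b ∷ [])) ++ reverse (decodeAux 0 as)
  snoc b as = trans (cong reverse (decodeAux-++ 0 as (b ∷ []))) (reverse-++ (decodeAux 0 as) _)
  #1-reverse : ∀ bs → #1 (reverse bs) ≡ #1 bs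
  #1-reverse []       = refl
  #1-reverse (b ∷ bs) rewrite unfold-reverse b bs | #1-++ (reverse bs) (b ∷ []) | #1-reverse bs = trans (+-comm (#1 bs) _) (sym (#1-++ (b ∷ []) bs))
  go : ∀ c bs → map ((c + #1 bs) ∸_) (decodeAux c bs) ≡ decode (reverse bs)
  go c []           = refl
  go c (true  ∷ bs) rewrite +-suc c (#1 bs) | unfold-reverse true bs =
    trans (go (suc c) bs) (sym (snoc true (reverse bs)))
  go c (false ∷ bs) rewrite unfold-reverse false bs | m+n∸m≡n c (#1 bs) =
    trans (cong₂ _∷_ (sym (#1-reverse bs)) (go c bs)) (sym (snoc false (reverse bs)))

≤ᵇ-yes : ∀ {a b} → a ≤ b → (a ≤ᵇ b) ≡ true
≤ᵇ-yes {a} {b} a≤b with a ≤ᵇ b | ≤⇒≤ᵇ a≤b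
... | true | _ = refl
≤ᵇ-no : ∀ {a b} → b < a → (a ≤ᵇ b) ≡ false
≤ᵇ-no {a} {b} b<a with a ≤ᵇ b | ≤ᵇ⇒≤ a b
... | false | _ = refl
... | true  | f = contradiction (f _) (<⇒≱ b<a)

-- Complementation reverses the bit string; transposition reverses and negates it.
transp-compl-decode : ∀ j bs → #1 bs ≡ j → transp j (compl j (decode bs)) ≡ decode (map not bs)
transp-compl-decode j bs refl = begin
  map (λ i → atLeast i (compl j (decode bs))) (oneTo j)
    ≡⟨ cong₂ (λ l → map (λ i → atLeast i l)) (compl-decode j bs) (oneTo≡range j) ⟩
  map (λ i → atLeast i (map (j ∸_) (decodeAux 0 bs))) (range 1 j)
    ≡⟨ sym (reverse-involutive _) ⟩
  reverse (reverse (map (λ i → atLeast i (map (j ∸_) (decodeAux 0 bs))) (range 1 j)))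
    ≡⟨ cong reverse (go 0 0 j bs refl refl) ⟩
  reverse (decodeAux 0 (map not bs)) ∎
  where
  open ≡-Reasoning
  atLeast : ℕ → List ℕ → ℕ
  atLeast i l = sum (map (λ x → if i ≤ᵇ x then 1 else 0) l)
  none-above : ∀ J i c bs → J ∸ c < i → atLeast i (map (J ∸_) (decodeAux c bs)) ≡ 0
  none-above J i c []           _ = refl
  none-above J i c (true  ∷ bs) p = none-above J i (suc c) bs (≤-<-trans (∸-monoʳ-≤ J (n≤1+n c)) p)
  none-above J i c (false ∷ bs) p rewrite ≤ᵇ-no p = none-above J i c bs p
  column : ℕ → ℕ → ℕ → List Bool → ℕ → ℕ
  column J z c bs i = z + atLeast i (map (J ∸_) (decodeAux c bs))
  range-bounded : ∀ k n → All (_< k + n) (range k n)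
  range-bounded k zero    = []
  range-bounded k (suc n) = m<m+n k (s≤s z≤n) ∷ subst (λ z → All (_< z) (range (suc k) n)) (sym (+-suc k n)) (range-bounded (suc k) n)
  -- After `z` zeros and `c` ones, `k` columns remain. A one completes column `k`, which no later
  -- part reaches, at height `z`; a zero is a part `j - c = k` and so raises all `k` columns by one.
  go : ∀ z c k bs → #1 bs ≡ k → c + k ≡ j →
    reverse (map (column j z c bs) (range 1 k)) ≡ decodeAux z (map not bs)
  go z c k [] refl _ = refl
  go z c k (true ∷ bs) p q with p
  ... | refl = begin
    reverse (map col (range 1 (suc k′)))            ≡⟨ cong (reverse ∘ map col) (range-∷ʳ 1 k′) ⟩
    reverse (map col (range 1 k′ ∷ʳ suc k′))        ≡⟨ cong reverse (map-++ col (range 1 k′) _) ⟩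
    reverse (map col (range 1 k′) ∷ʳ col (suc k′))  ≡⟨ reverse-++ (map col (range 1 k′)) _ ⟩
    col (suc k′) ∷ reverse (map col (range 1 k′))
      ≡⟨ cong₂ _∷_ (trans (cong (z +_) (none-above j (suc k′) (suc c) bs (s≤s (≤-reflexive (trans (cong (_∸ suc c) (sym q′)) (m+n∸m≡n (suc c) k′))))))
           (+-identityʳ z)) (go z (suc c) k′ bs refl q′) ⟩
    z ∷ decodeAux z (map not bs) ∎
    where
    k′ = #1 bs
    col = column j z c (true ∷ bs)
    q′ : suc c + k′ ≡ j
    q′ = trans (sym (+-suc c k′)) q
  go z c k (false ∷ bs) p q = trans (cong reverse (map-cong-local (All.map grow (range-bounded 1 k))))
    (go (suc z) c k bs p q)
    where
    grow : ∀ {i} → i < suc k → column j z c (false ∷ bs) i ≡ column j (suc z) c bs i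
    grow {i} i≤k rewrite ≤ᵇ-yes {i} {j ∸ c} (≤-trans (≤-pred i≤k) (≤-reflexive (sym (trans (cong (_∸ c) (sym q)) (m+n∸m≡n c k))))) = +-suc z _

-- A zero preceded by `i` zeros and `c` ones is row `i + 1` of the complement, with part `r - c`. It
-- contains a diagonal cell exactly when `i + c < r`, that is, when the zero is among the first `r`
-- bits.
diag0-compl-decode : ∀ r bs → diag0 (compl r (decode bs)) ≡ #0 (take r bs)
diag0-compl-decode r bs = trans (cong diag0 (compl-decode r bs)) (go 0 0 bs)
  where
  pred-∸ : ∀ x → r ∸ suc x ≡ pred (r ∸ x)
  pred-∸ x = sym (pred[m∸n]≡m∸[1+n] r x)
  go : ∀ i c bs → diag0Aux (suc i) (map (r ∸_) (decodeAux c bs)) ≡ #0 (take (r ∸ (i + c)) bs)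
  go i c [] with r ∸ (i + c)
  ... | zero  = refl
  ... | suc _ = refl
  go i c (true ∷ bs) = trans (go i (suc c) bs)
    (trans (cong (λ z → #0 (take z bs)) (trans (cong (r ∸_) (+-suc i c)) (pred-∸ (i + c)))) (skip (r ∸ (i + c))))
    where
    skip : ∀ k → #0 (take (pred k) bs) ≡ #0 (take k (true ∷ bs))
    skip zero    = refl
    skip (suc k) = refl
  go i c (false ∷ bs) = trans (cong (λ z → (if suc i ≤ᵇ (r ∸ c) then 1 else 0) + z)
      (trans (go (suc i) c bs) (cong (λ z → #0 (take z bs)) (pred-∸ (i + c)))))
    (visit (r ∸ (i + c)) (trans (cong (r ∸_) (+-comm i c)) (sym (∸-+-assoc r c i))))
    where
    i<r∸c : ∀ {k} → suc k ≡ r ∸ c ∸ i → i < r ∸ c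
    i<r∸c e = ≰⇒> (λ le → contradiction (trans e (m≤n⇒m∸n≡0 le)) 1+n≢0)
    visit : ∀ k → k ≡ r ∸ c ∸ i → (if suc i ≤ᵇ (r ∸ c) then 1 else 0) + #0 (take (pred k) bs) ≡ #0 (take k (false ∷ bs))
    visit zero    k≡ rewrite ≤ᵇ-no {suc i} {r ∸ c} (s≤s (m∸n≡0⇒m≤n (sym k≡))) = refl
    visit (suc k) k≡ rewrite ≤ᵇ-yes {suc i} {r ∸ c} (i<r∸c k≡) = refl

<⇒≡ᵇ-false : ∀ {a b} → a < b → (b ≡ᵇ a) ≡ false
<⇒≡ᵇ-false {zero}  {suc b} _         = refl
<⇒≡ᵇ-false {suc a} {suc b} (s≤s a<b) = <⇒≡ᵇ-false a<b

<⇒≡ᵇ-false′ : ∀ {a b} → a < b → (a ≡ᵇ b) ≡ false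
<⇒≡ᵇ-false′ {zero}  {suc b} _         = refl
<⇒≡ᵇ-false′ {suc a} {suc b} (s≤s a<b) = <⇒≡ᵇ-false′ a<b

≡ᵇ-refl : ∀ a → (a ≡ᵇ a) ≡ true
≡ᵇ-refl zero    = refl
≡ᵇ-refl (suc a) = ≡ᵇ-refl a

member-below : ∀ {i k} bs → i < k → member i (ones k bs) ≡ false
member-below []           _   = refl
member-below (true  ∷ bs) i<k rewrite <⇒≡ᵇ-false′ i<k = member-below bs (m<n⇒m<1+n i<k)
member-below (false ∷ bs) i<k = member-below bs (m<n⇒m<1+n i<k)

-- The predicate is abstract because the list tested in `wOf` stays fixed while the recursion
-- shortens the string. Agreement is required only from `k` on, where the entries already passed do
-- not matter.
filter-nonmembers : ∀ {q : ℕ → Bool} k bs → (∀ {x} → k ≤ x → q x ≡ member x (ones k bs)) →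
  filterᵇ (not ∘ q) (range k (length bs)) ≡ zeros k bs
filter-nonmembers k []           q≈ = refl
filter-nonmembers {q} k (true ∷ bs) q≈
  rewrite q≈ (≤-refl {k}) | ≡ᵇ-refl k = filter-nonmembers (suc k) bs q≈′
  where
  q≈′ : ∀ {x} → suc k ≤ x → q x ≡ member x (ones (suc k) bs)
  q≈′ {x} k<x = trans (q≈ (<⇒≤ k<x)) (cong (_∨ member x (ones (suc k) bs)) (<⇒≡ᵇ-false k<x))
filter-nonmembers k (false ∷ bs) q≈
  rewrite q≈ (≤-refl {k}) | member-below {k} bs ≤-refl = cong (k ∷_) (filter-nonmembers (suc k) bs (q≈ ∘ <⇒≤))

-- The `i`-th zero is preceded by `i - 1` zeros and by as many ones as its part, so its position is
-- the part plus `i`: the defining formula of `w_λ(i)`.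
zip-decodeAux : ∀ c z bs → zipWith _+_ (decodeAux c bs) (range (suc z) (length (decodeAux c bs))) ≡ zeros (suc (c + z)) bs
zip-decodeAux c z []           = refl
zip-decodeAux c z (true  ∷ bs) = zip-decodeAux (suc c) z bs
zip-decodeAux c z (false ∷ bs) rewrite +-suc c z =
  cong (suc (c + z) ∷_) (trans (zip-decodeAux c (suc z) bs) (cong (λ y → zeros (suc y) bs) (+-suc c z)))

wOf-decode : ∀ bs {n} → length bs ≡ n → wOf n (decode bs) ≡ zeros 1 bs ++ ones 1 bs
wOf-decode bs refl = begin
  wOf (length bs) (decode bs) ≡⟨ cong (λ l → l ++ filterᵇ (λ x → not (member x l)) (oneTo (length bs))) first ⟩
  zeros 1 bs ++ filterᵇ (λ x → not (member x (zeros 1 bs))) (oneTo (length bs)) ≡⟨ cong (zeros 1 bs ++_) rest ⟩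
  zeros 1 bs ++ ones 1 bs ∎
  where
  open ≡-Reasoning
  first : zipWith _+_ (reverse (decode bs)) (oneTo (length (decode bs))) ≡ zeros 1 bs
  first rewrite reverse-involutive (decodeAux 0 bs) | length-reverse (decodeAux 0 bs)
              | oneTo≡range (length (decodeAux 0 bs)) = zip-decodeAux 0 0 bs
  rest : filterᵇ (λ x → not (member x (zeros 1 bs))) (oneTo (length bs)) ≡ ones 1 bs
  rest = begin
    filterᵇ (λ x → not (member x (zeros 1 bs))) (oneTo (length bs))
      ≡⟨ cong (filterᵇ _) (trans (oneTo≡range (length bs)) (cong (range 1) (sym (length-map not bs)))) ⟩
    filterᵇ (λ x → not (member x (zeros 1 bs))) (range 1 (length (map not bs)))
      ≡⟨ filter-nonmembers 1 (map not bs) (λ _ → refl) ⟩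
    ones 1 (map not (map not bs)) ≡⟨ cong (ones 1) (map-not-involutive bs) ⟩
    ones 1 bs ∎

-- The transposed complement has the negated string, so the two blocks of `wOf-decode` change
-- places.
phiJ-decode : ∀ bs {n j} → length bs ≡ n → #1 bs ≡ j → phiJ n j (decode bs) ≡ ones 1 bs ++ zeros 1 bs
phiJ-decode bs {n} {j} p q = begin
  wOf n (transp j (compl j (decode bs))) ≡⟨ cong (wOf n) (transp-compl-decode j bs q) ⟩
  wOf n (decode (map not bs))            ≡⟨ wOf-decode (map not bs) (trans (length-map not bs) p) ⟩
  zeros 1 (map not bs) ++ zeros 1 bs     ≡⟨ cong (λ l → ones 1 l ++ zeros 1 bs) (map-not-involutive bs) ⟩
  ones 1 bs ++ zeros 1 bs ∎
  where open ≡-Reasoning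

-- Complementation and left multiplication by `w0` both read the string backwards; together they
-- only reverse the order within each block.
comp-w0-wOf : ∀ bs {n j} → length bs ≡ n → #1 bs ≡ j →
  comp (w0 n) (wOf n (compl j (decode bs))) ≡ reverse (zeros 1 bs) ++ reverse (ones 1 bs)
comp-w0-wOf bs {n} {j} p q = begin
  comp (w0 n) (wOf n (compl j (decode bs)))       ≡⟨ cong (comp (w0 n) ∘ wOf n) (compl-decode-reverse j bs q) ⟩
  comp (w0 n) (wOf n (decode (reverse bs)))       ≡⟨ cong (comp (w0 n)) (wOf-decode (reverse bs) p′) ⟩
  comp (w0 n) (zeros 1 (reverse bs) ++ ones 1 (reverse bs)) ≡⟨ map-++ (row (w0 n)) (zeros 1 (reverse bs)) _ ⟩
  comp (w0 n) (zeros 1 (reverse bs)) ++ comp (w0 n) (ones 1 (reverse bs))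
    ≡⟨ cong₂ _++_ (comp-w0-zeros (reverse bs) p′) (comp-w0-ones (reverse bs) p′) ⟩
  reverse (zeros 1 (reverse (reverse bs))) ++ reverse (ones 1 (reverse (reverse bs)))
    ≡⟨ cong (λ l → reverse (zeros 1 l) ++ reverse (ones 1 l)) (reverse-involutive bs) ⟩
  reverse (zeros 1 bs) ++ reverse (ones 1 bs) ∎
  where
  open ≡-Reasoning
  p′ = trans (length-reverse bs) p

conj-wOf : ∀ bs {n j} → length bs ≡ n → #1 bs ≡ j → conj n (wOf n (compl j (decode bs))) ≡ ones 1 bs ++ zeros 1 bs
conj-wOf bs {n} {j} p q = begin
  conj n (wOf n (compl j (decode bs)))                        ≡⟨ cong (λ l → comp l (w0 n)) (comp-w0-wOf bs p q) ⟩
  comp (reverse (zeros 1 bs) ++ reverse (ones 1 bs)) (w0 n)   ≡⟨ cong (λ l → comp l (w0 n)) (sym (reverse-++ (ones 1 bs) (zeros 1 bs))) ⟩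
  comp (reverse (ones 1 bs ++ zeros 1 bs)) (w0 n)             ≡⟨ comp-w0 (reverse (ones 1 bs ++ zeros 1 bs)) len ⟩
  reverse (reverse (ones 1 bs ++ zeros 1 bs))                 ≡⟨ reverse-involutive _ ⟩
  ones 1 bs ++ zeros 1 bs ∎
  where
  open ≡-Reasoning
  len : length (reverse (ones 1 bs ++ zeros 1 bs)) ≡ n
  len = trans (length-reverse (ones 1 bs ++ zeros 1 bs)) 
    (trans (length-++ (ones 1 bs)) (trans (cong₂ _+_ (length-ones 1 bs) (length-ones 1 (map not bs))) (trans (+-comm (#1 bs) (#0 bs)) (trans (#0+#1 bs) p))))

-- The bit string of a partition

-- The rows from top to bottom between the bounds `c` and `r`: the condition under which every
-- truncated subtraction in `bitsAux` is exact.
Ascending : ℕ → List ℕ → ℕ → Set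
Ascending c []       r = c ≤ r
Ascending c (x ∷ xs) r = c ≤ x × Ascending x xs r

ascending-∷ʳ : ∀ {c x r} xs → Ascending c xs x → x ≤ r → Ascending c (xs ∷ʳ x) r
ascending-∷ʳ []       c≤x         x≤r = c≤x , x≤r
ascending-∷ʳ (y ∷ xs) (c≤y , asc) x≤r = c≤y , ascending-∷ʳ xs asc x≤r

ascending-reverse : ∀ {r} xs → Decreasing xs → row xs 1 ≤ r → Ascending 0 (reverse xs) r
ascending-reverse []           _          _   = z≤n
ascending-reverse (x ∷ [])     _          x≤r = z≤n , x≤r
ascending-reverse (x ∷ y ∷ xs) (y≤x , xs↓) x≤r =
  subst (λ l → Ascending 0 l _) (sym (unfold-reverse x (y ∷ xs)))
    (ascending-∷ʳ (reverse (y ∷ xs)) (ascending-reverse (y ∷ xs) xs↓ y≤x) x≤r)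

decode-bitsAux : ∀ {c r} xs → Ascending c xs r → decodeAux c (bitsAux r c xs) ≡ xs
decode-bitsAux {c} {r} [] _ = trans (cong (decodeAux c) (sym (++-identityʳ (replicate (r ∸ c) true)))) (decodeAux-replicate-true c (r ∸ c) [])
decode-bitsAux {c} {r} (x ∷ xs) (c≤x , asc) = begin
  decodeAux c (replicate (x ∸ c) true ++ false ∷ bitsAux r x xs) ≡⟨ decodeAux-replicate-true c (x ∸ c) _ ⟩
  decodeAux (c + (x ∸ c)) (false ∷ bitsAux r x xs)               ≡⟨ cong (λ z → decodeAux z (false ∷ bitsAux r x xs)) (m+[n∸m]≡n c≤x) ⟩
  x ∷ decodeAux x (bitsAux r x xs)                               ≡⟨ cong (x ∷_) (decode-bitsAux xs asc) ⟩
  x ∷ xs ∎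
  where open ≡-Reasoning

#1-replicate-true : ∀ n → #1 (replicate n true) ≡ n
#1-replicate-true zero    = refl
#1-replicate-true (suc n) = cong suc (#1-replicate-true n)

#1-bitsAux : ∀ {c r} xs → Ascending c xs r → c + #1 (bitsAux r c xs) ≡ r
#1-bitsAux {c} {r} []       c≤r = trans (cong (c +_) (#1-replicate-true (r ∸ c))) (m+[n∸m]≡n c≤r)
#1-bitsAux {c} {r} (x ∷ xs) (c≤x , asc) = begin
  c + #1 (replicate (x ∸ c) true ++ false ∷ bitsAux r x xs)
    ≡⟨ cong (c +_) (trans (#1-++ (replicate (x ∸ c) true) _) (cong (_+ #1 (bitsAux r x xs)) (#1-replicate-true (x ∸ c)))) ⟩
  c + (x ∸ c + #1 (bitsAux r x xs))  ≡⟨ sym (+-assoc c (x ∸ c) _) ⟩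
  c + (x ∸ c) + #1 (bitsAux r x xs)  ≡⟨ cong (_+ #1 (bitsAux r x xs)) (m+[n∸m]≡n c≤x) ⟩
  x + #1 (bitsAux r x xs)            ≡⟨ #1-bitsAux xs asc ⟩
  r ∎
  where open ≡-Reasoning

module Bits {m r lam} (inRect : InRect m r lam) where
  asc : Ascending 0 (reverse lam) r
  asc = ascending-reverse lam (proj₁ (proj₂ inRect)) (proj₂ (proj₂ inRect) 1)

  decode-bits : decode (bits r lam) ≡ lam
  decode-bits = trans (cong reverse (decode-bitsAux (reverse lam) asc)) (reverse-involutive lam)

  #1-bits : #1 (bits r lam) ≡ r
  #1-bits = #1-bitsAux (reverse lam) asc

  #0-bits : #0 (bits r lam) ≡ m
  #0-bits = begin
    #0 (bits r lam)                     ≡⟨ sym (length-decodeAux 0 (bits r lam)) ⟩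
    length (decodeAux 0 (bits r lam))   ≡⟨ sym (length-reverse (decodeAux 0 (bits r lam))) ⟩
    length (decode (bits r lam))        ≡⟨ cong length decode-bits ⟩
    length lam                          ≡⟨ proj₁ inRect ⟩
    m ∎
    where open ≡-Reasoning

  length-bits : length (bits r lam) ≡ m + r
  length-bits = trans (sym (#0+#1 (bits r lam))) (cong₂ _+_ #0-bits #1-bits)

conj-wOf≡phiJ : ∀ {m r lam} → InRect m r lam → conj (m + r) (wOf (m + r) (compl r lam)) ≡ phiJ (m + r) r lam
conj-wOf≡phiJ {m} {r} {lam} inRect = subst (λ l → conj (m + r) (wOf (m + r) (compl r l)) ≡ phiJ (m + r) r l) decode-bits
  (trans (conj-wOf (bits r lam) length-bits #1-bits) (sym (phiJ-decode (bits r lam) length-bits #1-bits)))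
  where open Bits inRect

-- Reversal is the reflection of `i` to `n - i`, which turns the distance from `m` into the distance
-- from `r`.
reverse-degPeak : ∀ m r t → reverse (degPeak (m + r) m t) ≡ degPeak (m + r) r t
reverse-degPeak m r t = begin
  reverse (map peak (oneTo k))                      ≡⟨ sym (reverse-map peak (oneTo k)) ⟩
  map peak (reverse (oneTo k))                      ≡⟨ cong (map peak ∘ reverse) (oneTo≡range k) ⟩
  map peak (reverse (range 1 k))                    ≡⟨ cong (map peak) (sym flip) ⟩
  map peak (map (suc k ∸_) (range 1 k))             ≡⟨ sym (map-∘ (range 1 k)) ⟩
  map (peak ∘ (suc k ∸_)) (range 1 k)               ≡⟨ map-cong-local (All.map mirror (bounded 1 k refl)) ⟩
  map (λ i → t ∸ ∣ i - r ∣) (range 1 k)             ≡⟨ cong (map _) (sym (oneTo≡range k)) ⟩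
  map (λ i → t ∸ ∣ i - r ∣) (oneTo k) ∎
  where
  open ≡-Reasoning
  k = m + r ∸ 1
  peak : ℕ → ℕ
  peak i = t ∸ ∣ i - m ∣
  -- `range 1 k` lists the ones of a string of `k` ones, a palindrome, so `ones-reverse` applies.
  flip : map (suc k ∸_) (range 1 k) ≡ reverse (range 1 k)
  flip = subst (λ l → map (suc k ∸_) l ≡ reverse l) (ones-replicate-true 1 k)
    (subst₂ (λ j bs → map (suc j ∸_) (ones 1 (replicate k true)) ≡ reverse (ones 1 bs))
      (length-replicate k) (reverse-replicate k true) (ones-reverse 1 (replicate k true)))
  bounded : ∀ a j {b} → a + j ≡ b → All (λ i → a ≤ i × i < b) (range a j)
  bounded a zero    _    = []
  bounded a (suc j) refl = (≤-refl , m<m+n a (s≤s z≤n)) ∷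
    All.map (λ (p , q) → <⇒≤ p , q) (bounded (suc a) j (sym (+-suc a j)))
  mirror : ∀ {i} → 1 ≤ i × i < suc k → peak (suc k ∸ i) ≡ t ∸ ∣ i - r ∣
  mirror {i} (1≤i , i≤k) = cong (t ∸_) (begin
    ∣ suc k ∸ i - m ∣           ≡⟨ sym (∣m+n-m+o∣≡∣n-o∣ i (suc k ∸ i) m) ⟩
    ∣ i + (suc k ∸ i) - i + m ∣ ≡⟨ cong₂ ∣_-_∣ (trans (m+[n∸m]≡n (<⇒≤ i≤k)) 1+k≡) (+-comm i m) ⟩
    ∣ m + r - m + i ∣           ≡⟨ ∣m+n-m+o∣≡∣n-o∣ m r i ⟩
    ∣ r - i ∣                   ≡⟨ ∣-∣-comm r i ⟩
    ∣ i - r ∣ ∎)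
    where
    -- The index `i`, lying between 1 and `k`, shows that `m + r` is positive, so subtracting 1
    -- loses nothing.
    1+k≡ : suc k ≡ m + r
    1+k≡ = m+[n∸m]≡n {1} {m + r} (≤-trans (≤-trans 1≤i (≤-pred i≤k)) (m∸n≤m (m + r) 1))

-- Decoding concatenated strings, and the string of ν ⊕ d.

#1-replicate-false : ∀ n → #1 (replicate n false) ≡ 0
#1-replicate-false zero    = refl
#1-replicate-false (suc n) = #1-replicate-false n

#0-replicate-false : ∀ n → #0 (replicate n false) ≡ n
#0-replicate-false n = trans (cong #1 (map-replicate not n false)) (#1-replicate-true n)

#0-replicate-true : ∀ n → #0 (replicate n true) ≡ 0
#0-replicate-true n = trans (cong #1 (map-replicate not n true)) (#1-replicate-false n)

length-decode : ∀ bs → length (decode bs) ≡ #0 bs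
length-decode bs = trans (length-reverse (decodeAux 0 bs)) (length-decodeAux 0 bs)

-- The bits of `bs` give the lower rows, which depend on `as` only through its number of ones.
-- Replacing `as` by that many ones removes exactly its own rows.
decode-++ : ∀ as bs {c} → #1 as ≡ c → decode (as ++ bs) ≡ decode (replicate c true ++ bs) ++ decode as
decode-++ as bs refl = begin
  reverse (decodeAux 0 (as ++ bs))                          ≡⟨ cong reverse (decodeAux-++ 0 as bs) ⟩
  reverse (decodeAux 0 as ++ decodeAux (#1 as) bs)          ≡⟨ reverse-++ (decodeAux 0 as) _ ⟩
  reverse (decodeAux (#1 as) bs) ++ decode as               ≡⟨ cong (λ l → reverse l ++ decode as) (sym (decodeAux-replicate-true 0 (#1 as) bs)) ⟩
  decode (replicate (#1 as) true ++ bs) ++ decode as ∎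
  where open ≡-Reasoning

decode-++-true : ∀ bs n → decode (bs ++ replicate n true) ≡ decode bs
decode-++-true bs n = cong reverse (begin
  decodeAux 0 (bs ++ replicate n true)              ≡⟨ decodeAux-++ 0 bs (replicate n true) ⟩
  decodeAux 0 bs ++ decodeAux (#1 bs) (replicate n true) ≡⟨ cong (λ l → decodeAux 0 bs ++ decodeAux (#1 bs) l) (sym (++-identityʳ (replicate n true))) ⟩
  decodeAux 0 bs ++ decodeAux (#1 bs) (replicate n true ++ []) ≡⟨ cong (decodeAux 0 bs ++_) (decodeAux-replicate-true (#1 bs) n []) ⟩
  decodeAux 0 bs ++ []                              ≡⟨ ++-identityʳ _ ⟩
  decodeAux 0 bs ∎)
  where open ≡-Reasoning

decode-++-false : ∀ bs n → decode (bs ++ replicate n false) ≡ replicate n (#1 bs) ++ decode bs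
decode-++-false bs n = begin
  reverse (decodeAux 0 (bs ++ replicate n false))                  ≡⟨ cong reverse (decodeAux-++ 0 bs _) ⟩
  reverse (decodeAux 0 bs ++ decodeAux (#1 bs) (replicate n false)) ≡⟨ reverse-++ (decodeAux 0 bs) _ ⟩
  reverse (decodeAux (#1 bs) (replicate n false)) ++ decode bs     ≡⟨ cong (λ l → reverse l ++ decode bs) (decodeAux-replicate-false (#1 bs) n) ⟩
  reverse (replicate n (#1 bs)) ++ decode bs                       ≡⟨ cong (_++ decode bs) (reverse-replicate n (#1 bs)) ⟩
  replicate n (#1 bs) ++ decode bs ∎
  where open ≡-Reasoning

decode-false-++ : ∀ n bs → decode (replicate n false ++ bs) ≡ decode bs ++ replicate n 0
decode-false-++ n bs = begin
  decode (replicate n false ++ bs)                ≡⟨ decode-++ (replicate n false) bs (#1-replicate-false n) ⟩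
  decode bs ++ decode (replicate n false)         ≡⟨ cong (decode bs ++_) (decode-++-false [] n) ⟩
  decode bs ++ (replicate n 0 ++ [])              ≡⟨ cong (decode bs ++_) (++-identityʳ (replicate n 0)) ⟩
  decode bs ++ replicate n 0 ∎
  where open ≡-Reasoning

#1≡0⇒replicate : ∀ bs → #1 bs ≡ 0 → bs ≡ replicate (length bs) false
#1≡0⇒replicate []           _ = refl
#1≡0⇒replicate (false ∷ bs) p = cong (false ∷_) (#1≡0⇒replicate bs p)

first-one : ∀ bs {d} → #1 bs ≡ suc d → ∃[ q ] ∃[ bs′ ] bs ≡ replicate q false ++ true ∷ bs′ × #1 bs′ ≡ d
first-one (true  ∷ bs) p = 0 , bs , refl , suc-injective p
first-one (false ∷ bs) p with first-one bs p
... | q , bs′ , refl , p′ = suc q , bs′ , refl , p′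

All-reverse : ∀ {P : ℕ → Set} {xs} → All P xs → All P (reverse xs)
All-reverse {xs = []}     []         = []
All-reverse {P} {x ∷ xs} (px ∷ pxs) =
  subst (All P) (sym (unfold-reverse x xs)) (++⁺ (All-reverse pxs) (px ∷ []))

-- The induction moves the cut P | S past the first one of S.
addHooks-decode : ∀ {B ν d ρ} P S → 0 < #1 B → Decreasing ν → ν ≡ decode B → P ++ S ≡ B →
  AddHooks (#0 B + #1 B) (#1 B) ν d ρ → #1 S ≡ d → ρ ≋ decode (S ++ P ++ replicate (length S) false)
-- No one is left to move: `S` is a block of zeros, and placing it in front only adds empty rows.
addHooks-decode P S 0<r ν↓ refl refl none #S i = sym (begin
  row (decode (S ++ P ++ Z)) (suc i)                 ≡⟨ cong (λ l → row (decode (l ++ P ++ Z)) (suc i)) S≡Z ⟩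
  row (decode (Z ++ P ++ Z)) (suc i)                 ≡⟨ cong (λ l → row l (suc i)) (decode-false-++ (length S) (P ++ Z)) ⟩
  row (decode (P ++ Z) ++ replicate (length S) 0) (suc i) ≡⟨ row-++-zeros (decode (P ++ Z)) (length S) i ⟩
  row (decode (P ++ Z)) (suc i)                      ≡⟨ cong (λ l → row (decode (P ++ l)) (suc i)) (sym S≡Z) ⟩
  row (decode (P ++ S)) (suc i) ∎)
  where
  open ≡-Reasoning
  Z = replicate (length S) false
  S≡Z = #1≡0⇒replicate S #S
addHooks-decode {B} P S 0<r ν↓ ν≡ PS≡B (more {rho = ρ} {sigma = σ} hooks hook) #S i with first-one S #S
-- The earlier hooks have moved the ones of `S′`, so ρ has the string `S′ P 0^q 1 0^a`. Its last one
-- is the first one of `S`, and the `a` zeros behind it are the full rows.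
... | q , S′ , refl , #S′ = begin
  row σ (suc i)                                           ≡⟨ σ≋ i ⟩
  row (replicate (suc a) (#1 B) ++ map suc (decode M)) (suc i) ≡⟨ cong (λ l → row l (suc i)) (sym new) ⟩
  -- The `q` zeros that precede the first one of `S` are put back in front, as empty rows.
  row (decode (true ∷ M ++ 0s (suc a))) (suc i)           ≡⟨ sym (row-++-zeros (decode (true ∷ M ++ 0s (suc a))) q i) ⟩
  row (decode (true ∷ M ++ 0s (suc a)) ++ replicate q 0) (suc i) ≡⟨ cong (λ l → row l (suc i)) (sym (decode-false-++ q _)) ⟩
  row (decode (0s q ++ true ∷ M ++ 0s (suc a))) (suc i)   ≡⟨ cong (λ l → row (decode l) (suc i)) regroup ⟩
  row (decode (S ++ P ++ 0s (length S))) (suc i) ∎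
  where
  open ≡-Reasoning
  0s : ℕ → List Bool
  0s k = replicate k false
  a = length S′
  M = S′ ++ P ++ 0s q
  P′ = P ++ 0s q ++ true ∷ []
  P′S′≡B : P′ ++ S′ ≡ B
  P′S′≡B = trans (trans (++-assoc P _ S′) (cong (P ++_) (++-assoc (0s q) _ S′))) PS≡B
  old : S′ ++ P′ ++ 0s a ≡ (M ∷ʳ true) ++ 0s a
  old = solve (++-monoid Bool)
  #1M : #1 (M ∷ʳ true) ≡ #1 B
  #1M = begin
    #1 (M ∷ʳ true) ≡⟨ cong #1 {M ∷ʳ true} {S′ ++ P′} (solve (++-monoid Bool)) ⟩
    #1 (S′ ++ P′)  ≡⟨ #1-++ S′ P′ ⟩
    #1 S′ + #1 P′  ≡⟨ +-comm (#1 S′) _ ⟩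
    #1 P′ + #1 S′  ≡⟨ sym (#1-++ P′ S′) ⟩
    #1 (P′ ++ S′)  ≡⟨ cong #1 P′S′≡B ⟩
    #1 B ∎
  #0M : #0 M ≡ #0 B
  #0M = begin
    #0 M           ≡⟨ sym (+-identityʳ _) ⟩
    #0 M + 0       ≡⟨ sym (#0-++ M (true ∷ [])) ⟩
    #0 (M ∷ʳ true) ≡⟨ cong #0 {M ∷ʳ true} {S′ ++ P′} (solve (++-monoid Bool)) ⟩
    #0 (S′ ++ P′)  ≡⟨ #0-++ S′ P′ ⟩
    #0 S′ + #0 P′  ≡⟨ +-comm (#0 S′) _ ⟩
    #0 P′ + #0 S′  ≡⟨ sym (#0-++ P′ S′) ⟩
    #0 (P′ ++ S′)  ≡⟨ cong #0 P′S′≡B ⟩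
    #0 B ∎
  1+#1M : suc (#1 M) ≡ #1 B
  1+#1M = trans (sym (trans (#1-++ M (true ∷ [])) (+-comm (#1 M) 1))) #1M
  ρ≋ : ρ ≋ (replicate a (#1 B) ++ decode M)
  ρ≋ i = begin
    row ρ (suc i)                                ≡⟨ addHooks-decode P′ S′ 0<r ν↓ ν≡ P′S′≡B hooks #S′ i ⟩
    row (decode (S′ ++ P′ ++ 0s a)) (suc i)      ≡⟨ cong (λ l → row (decode l) (suc i)) old ⟩
    row (decode ((M ∷ʳ true) ++ 0s a)) (suc i)   ≡⟨ cong (λ l → row l (suc i)) (decode-++-false (M ∷ʳ true) a) ⟩
    row (replicate a (#1 (M ∷ʳ true)) ++ decode (M ∷ʳ true)) (suc i)
      ≡⟨ cong₂ (λ c l → row (replicate a c ++ l) (suc i)) #1M (decode-++-true M 1) ⟩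
    row (replicate a (#1 B) ++ decode M) (suc i) ∎
  σ≋ : σ ≋ (replicate (suc a) (#1 B) ++ map suc (decode M))
  σ≋ = addHook-shape a 0<r (addHooks-decreasing ν↓ hooks) (trans (length-decode M) #0M)
    (All-reverse (All.map (λ p → <-≤-trans (s≤s p) (≤-reflexive 1+#1M)) (decodeAux-≤ 0 M))) ρ≋ hook
  -- The leading one raises every part of `decode M`; the zero left in the place of the moved one is
  -- the new full row.
  new : decode (true ∷ M ++ 0s (suc a)) ≡ replicate (suc a) (#1 B) ++ map suc (decode M)
  new = trans (decode-++-false (true ∷ M) (suc a)) (cong₂ (λ c l → replicate (suc a) c ++ l) 1+#1M
    (trans (cong reverse (decodeAux-suc 0 M)) (sym (reverse-map suc (decodeAux 0 M)))))
  replicate-+ : ∀ j k → 0s (j + k) ≡ 0s j ++ 0s k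
  replicate-+ zero    k = refl
  replicate-+ (suc j) k = cong (false ∷_) (replicate-+ j k)
  regroup : 0s q ++ true ∷ M ++ 0s (suc a) ≡ S ++ P ++ 0s (length S)
  regroup = begin
    0s q ++ true ∷ M ++ 0s (suc a)                          ≡⟨ assoc (0s q) (true ∷ []) S′ P (0s (suc a)) ⟩
    (0s q ++ true ∷ S′) ++ P ++ (0s q ++ 0s (suc a))        ≡⟨ cong (λ l → S ++ P ++ l) (sym (replicate-+ q (suc a))) ⟩
    S ++ P ++ 0s (q + suc a)                                ≡⟨ cong (λ k → S ++ P ++ 0s k) (sym (trans (length-++ (0s q)) (cong (_+ suc a) (length-replicate q)))) ⟩
    S ++ P ++ 0s (length S) ∎
    where
    assoc : ∀ (z o s p w : List Bool) → z ++ o ++ (s ++ p ++ z) ++ w ≡ (z ++ o ++ s) ++ p ++ (z ++ w)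
    assoc z o s p w = solve (++-monoid Bool)

-- Right multiplication by `w0P`, `w0P'` and `w0`.

comp-++ : ∀ u v w → comp u (v ++ w) ≡ comp u v ++ comp u w
comp-++ u = map-++ (row u)

comp-w0P : ∀ A C {m r} → length A ≡ m → length C ≡ r →
  comp (reverse A ++ reverse C) (w0P (m + r) m) ≡ A ++ C
comp-w0P A C {m} {r} p q = begin
  comp V (down 0 m ++ down m (m + r))             ≡⟨ comp-++ V (down 0 m) _ ⟩
  comp V (down 0 m) ++ comp V (down m (m + r))
    ≡⟨ cong₂ _++_ (comp-down [] (reverse A) (reverse C) refl p′)
         (trans (cong (λ l → comp (reverse A ++ l) (down m (m + r))) (sym (++-identityʳ (reverse C))))
           (comp-down (reverse A) (reverse C) [] p′ (trans (length-reverse C) q))) ⟩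
  reverse (reverse A) ++ reverse (reverse C)      ≡⟨ cong₂ _++_ (reverse-involutive A) (reverse-involutive C) ⟩
  A ++ C ∎
  where
  open ≡-Reasoning
  V = reverse A ++ reverse C
  p′ = trans (length-reverse A) p

-- `w0P'` reverses each of four blocks of sizes `m - t`, `t`, `t`, `r - t`. The final `w0` reverses
-- the whole list, which restores the inside of each block and inverts the order of the blocks.
comp-w0P'-w0 : ∀ A₁ A₂ A₃ A₄ {m r t} → length A₁ + t ≡ m → length A₂ ≡ t → length A₃ ≡ t → t + length A₄ ≡ r →
  comp (comp ((A₁ ++ A₂) ++ (A₃ ++ A₄)) (w0P' (m + r) m t)) (w0 (m + r)) ≡ A₄ ++ A₃ ++ A₂ ++ A₁
comp-w0P'-w0 A₁ A₂ A₃ A₄ {t = t} refl |A₂| |A₃| refl = begin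
  comp (comp V (w0P' n m t)) (w0 n)  ≡⟨ cong (λ l → comp l (w0 n)) blocks ⟩
  comp W (w0 n)                      ≡⟨ comp-w0 W |W| ⟩
  reverse W                          ≡⟨ reverse-blocks ⟩
  A₄ ++ A₃ ++ A₂ ++ A₁ ∎
  where
  open ≡-Reasoning
  a₁ = length A₁
  a₄ = length A₄
  m = a₁ + t
  r = t + a₄
  n = m + r
  V = (A₁ ++ A₂) ++ (A₃ ++ A₄)
  W = reverse A₁ ++ reverse A₂ ++ reverse A₃ ++ reverse A₄
  n≡ : n ≡ (m + t) + a₄
  n≡ = sym (+-assoc m t a₄)
  |A₁₂| : length (A₁ ++ A₂) ≡ m
  |A₁₂| = trans (length-++ A₁) (cong (a₁ +_) |A₂|)
  |A₁₂₃| : length ((A₁ ++ A₂) ++ A₃) ≡ m + t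
  |A₁₂₃| = trans (length-++ (A₁ ++ A₂)) (cong₂ _+_ |A₁₂| |A₃|)
  block₁ : comp V (down 0 (m ∸ t)) ≡ reverse A₁
  block₁ = trans (cong₂ (λ l k → comp l (down 0 k)) {V} {A₁ ++ A₂ ++ A₃ ++ A₄} (++-assoc A₁ A₂ _) (m+n∸n≡m a₁ t))
    (comp-down [] A₁ (A₂ ++ A₃ ++ A₄) refl refl)
  block₂ : comp V (down (m ∸ t) m) ≡ reverse A₂
  block₂ = trans (cong₂ (λ l k → comp l (down k m)) {V} {A₁ ++ A₂ ++ A₃ ++ A₄} (++-assoc A₁ A₂ _) (m+n∸n≡m a₁ t))
    (comp-down A₁ A₂ (A₃ ++ A₄) refl |A₂|)
  block₃ : comp V (down m (m + t)) ≡ reverse A₃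
  block₃ = comp-down (A₁ ++ A₂) A₃ A₄ |A₁₂| |A₃|
  block₄ : comp V (down (m + t) n) ≡ reverse A₄
  block₄ = trans (cong₂ (λ l k → comp l (down (m + t) k)) {V} {((A₁ ++ A₂) ++ A₃) ++ A₄ ++ []} (solve (++-monoid ℕ)) n≡)
    (comp-down ((A₁ ++ A₂) ++ A₃) A₄ [] |A₁₂₃| refl)
  blocks : comp V (w0P' n m t) ≡ W
  blocks = trans (comp-++ V (down 0 (m ∸ t)) _) (cong₂ _++_ block₁
    (trans (comp-++ V (down (m ∸ t) m) _) (cong₂ _++_ block₂
      (trans (comp-++ V (down m (m + t)) _) (cong₂ _++_ block₃ block₄)))))
  reverse-blocks : reverse W ≡ A₄ ++ A₃ ++ A₂ ++ A₁
  reverse-blocks = begin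
    reverse W ≡⟨ cong reverse (sym (trans (reverse-++ A₄ _) (trans (cong (_++ reverse A₄) (trans (reverse-++ A₃ _) (cong (_++ reverse A₃) (reverse-++ A₂ A₁))))
       (shuffle (reverse A₁) (reverse A₂) (reverse A₃) (reverse A₄))))) ⟩
    reverse (reverse (A₄ ++ A₃ ++ A₂ ++ A₁)) ≡⟨ reverse-involutive _ ⟩
    A₄ ++ A₃ ++ A₂ ++ A₁ ∎
    where
    shuffle : ∀ (p q r s : List ℕ) → ((p ++ q) ++ r) ++ s ≡ p ++ q ++ r ++ s
    shuffle p q r s = solve (++-monoid ℕ)
  |W| : length W ≡ n
  |W| = begin
    length W                     ≡⟨ sym (length-reverse W) ⟩
    length (reverse W)           ≡⟨ cong length reverse-blocks ⟩
    length (A₄ ++ A₃ ++ A₂ ++ A₁)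
      ≡⟨ trans (length-++ A₄) (cong (a₄ +_) (trans (length-++ A₃) (cong₂ _+_ |A₃| (trans (length-++ A₂) (cong (_+ a₁) |A₂|))))) ⟩
    a₄ + (t + (t + a₁))          ≡⟨ solveℕ 3 (λ x y z → x :+ (y :+ (y :+ z)) := (z :+ y) :+ (y :+ x)) refl a₄ t a₁ ⟩
    n ∎

-- By associativity the left `w0` acts on `wOf` first and leaves zeros and ones in decreasing order;
-- `w0P` makes both blocks increasing again, and only the four-block reversal remains.
conj-twisted : ∀ bs A₁ A₂ A₃ A₄ {m r t} → #0 bs ≡ m → #1 bs ≡ r → zeros 1 bs ≡ A₁ ++ A₂ → ones 1 bs ≡ A₃ ++ A₄ →
  length A₁ + t ≡ m → length A₂ ≡ t → length A₃ ≡ t → t + length A₄ ≡ r →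
  conj (m + r) (comp (comp (wOf (m + r) (compl r (decode bs))) (w0P (m + r) m)) (w0P' (m + r) m t)) ≡ A₄ ++ A₃ ++ A₂ ++ A₁
conj-twisted bs A₁ A₂ A₃ A₄ {m} {r} {t} #0≡ #1≡ zeros≡ ones≡ e₁ e₂ e₃ e₄ = begin
  comp (comp (w0 n) (comp (comp w (w0P n m)) (w0P' n m t))) (w0 n)
    ≡⟨ cong (λ l → comp l (w0 n)) (trans (comp-assoc (w0 n) (comp w (w0P n m)) _) (cong (λ l → comp l (w0P' n m t)) (comp-assoc (w0 n) w _))) ⟩
  comp (comp (comp (comp (w0 n) w) (w0P n m)) (w0P' n m t)) (w0 n)
    ≡⟨ cong (λ l → comp (comp l (w0P' n m t)) (w0 n)) (trans (cong (λ l → comp l (w0P n m)) (comp-w0-wOf bs |bs| #1≡))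
         (comp-w0P (zeros 1 bs) (ones 1 bs) (trans (length-ones 1 (map not bs)) #0≡) (trans (length-ones 1 bs) #1≡))) ⟩
  comp (comp (zeros 1 bs ++ ones 1 bs) (w0P' n m t)) (w0 n)
    ≡⟨ cong₂ (λ k l → comp (comp (k ++ l) (w0P' n m t)) (w0 n)) zeros≡ ones≡ ⟩
  comp (comp ((A₁ ++ A₂) ++ (A₃ ++ A₄)) (w0P' n m t)) (w0 n) ≡⟨ comp-w0P'-w0 A₁ A₂ A₃ A₄ e₁ e₂ e₃ e₄ ⟩
  A₄ ++ A₃ ++ A₂ ++ A₁ ∎
  where
  open ≡-Reasoning
  n = m + r
  w = wOf n (compl r (decode bs))
  |bs| : length bs ≡ n
  |bs| = trans (sym (#0+#1 bs)) (cong₂ _+_ #0≡ #1≡)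

-- Both permutations for a string cut into `b`, `x`, `y`.

map-row-ones : ∀ xs k bs zs {a} → length xs ≡ a → map (row (xs ++ range k (length bs) ++ zs)) (ones (suc a) bs) ≡ ones k bs
map-row-ones xs k []       zs _ = refl
map-row-ones xs k (b ∷ bs) zs refl = here-or-later b
  where
  W = xs ++ k ∷ range (suc k) (length bs) ++ zs
  here′ : row W (suc (length xs)) ≡ k
  here′ = trans (cong (row W ∘ suc) (sym (+-identityʳ (length xs)))) (row-++ʳ xs _ 0)
  later : map (row W) (ones (suc (suc (length xs))) bs) ≡ ones (suc k) bs
  later = trans (cong (λ l → map (row l) (ones (suc (suc (length xs))) bs)) (sym (++-assoc xs (k ∷ []) _)))
    (map-row-ones (xs ∷ʳ k) (suc k) bs zs (trans (length-++ xs) (+-comm (length xs) 1)))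
  here-or-later : ∀ b → map (row W) (ones (suc (length xs)) (b ∷ bs)) ≡ ones k (b ∷ bs)
  here-or-later true  = cong₂ _∷_ here′ later
  here-or-later false = later

take-length-++ : ∀ {A : Set} (as bs : List A) {k} → length as ≡ k → take k (as ++ bs) ≡ as
take-length-++ []       bs refl = refl
take-length-++ (a ∷ as) bs refl = cong (a ∷_) (take-length-++ as bs refl)

drop-length-++ : ∀ {A : Set} (as bs : List A) {k} → length as ≡ k → drop k (as ++ bs) ≡ bs
drop-length-++ []       bs refl = refl
drop-length-++ (a ∷ as) bs refl = drop-length-++ as bs refl

split-length : ∀ {A : Set} (xs : List A) a c → length xs ≡ a + c → ∃[ F ] ∃[ G ] xs ≡ F ++ G × length F ≡ a × length G ≡ c
split-length xs zero    c p = [] , xs , refl , refl , p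
split-length (x ∷ xs) (suc a) c p with split-length xs a c (suc-injective p)
... | F , G , refl , p′ , q = x ∷ F , G , refl , cong suc p′ , q

split-#1 : ∀ bs {c d} → #1 bs ≡ c + d → ∃[ x ] ∃[ y ] bs ≡ x ++ y × #1 x ≡ c × #1 y ≡ d
split-#1 bs           {zero}  p = [] , bs , refl , refl , p
split-#1 (true  ∷ bs) {suc c} p with split-#1 bs {c} (suc-injective p)
... | x , y , refl , p′ , q = true ∷ x , y , refl , cong suc p′ , q
split-#1 (false ∷ bs) {suc c} p with split-#1 bs {suc c} p
... | x , y , refl , p′ , q = false ∷ x , y , refl , p′ , q

split-#0 : ∀ bs {c d} → #0 bs ≡ c + d → ∃[ x ] ∃[ y ] bs ≡ x ++ y × #0 x ≡ c × #0 y ≡ d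
split-#0 bs p with split-#1 (map not bs) p
... | x , y , e , p′ , q = map not x , map not y ,
  trans (sym (map-not-involutive bs)) (trans (cong (map not) e) (map-++ not x y)) ,
  trans (cong #1 (map-not-involutive x)) p′ , trans (cong #1 (map-not-involutive y)) q

-- b ++ x ++ y is the bit string of ν, cut after r bits and before its last d ones.
module Twist (b x y : List Bool) (#0b : #0 b ≡ #1 x + #1 y) where
  open ≡-Reasoning

  m r t d R Q : ℕ
  m = length x + length y
  r = length b
  t = #1 x
  d = #1 y
  -- `R` is `r - t`, the number of ones of `y b`; `Q` is `m - t`. As sums of counts they avoid
  -- truncated subtraction.
  R = d + #1 b
  Q = #0 x + length y

  t+R≡r : t + R ≡ r
  t+R≡r = trans (sym (+-assoc t d (#1 b))) (trans (cong (_+ #1 b) (sym #0b)) (#0+#1 b))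

  Q+t≡m : Q + t ≡ m
  Q+t≡m = trans (solveℕ 3 (λ z l o → (z :+ l) :+ o := (z :+ o) :+ l) refl (#0 x) (length y) t) (cong (_+ length y) (#0+#1 x))

  r∸t≡R : r ∸ t ≡ R
  r∸t≡R = trans (cong (_∸ t) (sym t+R≡r)) (m+n∸m≡n t R)

  m∸t≡Q : m ∸ t ≡ Q
  m∸t≡Q = trans (cong (_∸ t) (sym Q+t≡m)) (m+n∸n≡m Q t)

  -- `b` has `t + d` zeros, and `d` of them together with the zeros of `y` number `length y`. This
  -- is what allows the cut into `F` and the last `t` zeros `G`.
  tailZeros : length (zeros (suc (length x)) (y ++ b)) ≡ length y + t
  tailZeros = begin
    length (zeros (suc (length x)) (y ++ b)) ≡⟨ length-ones _ (map not (y ++ b)) ⟩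
    #0 (y ++ b)              ≡⟨ #0-++ y b ⟩
    #0 y + #0 b              ≡⟨ cong (#0 y +_) #0b ⟩
    #0 y + (t + d)           ≡⟨ solveℕ 3 (λ z t d → z :+ (t :+ d) := (z :+ d) :+ t) refl (#0 y) t d ⟩
    (#0 y + d) + t           ≡⟨ cong (_+ t) (#0+#1 y) ⟩
    length y + t ∎

  tailSplit = split-length (zeros (suc (length x)) (y ++ b)) (length y) t tailZeros

  F G O : List ℕ
  F = proj₁ tailSplit
  G = proj₁ (proj₂ tailSplit)
  O = ones (suc (length x)) (y ++ b)

  tail≡F++G : zeros (suc (length x)) (y ++ b) ≡ F ++ G
  tail≡F++G = proj₁ (proj₂ (proj₂ tailSplit))

  |F| : length F ≡ length y
  |F| = proj₁ (proj₂ (proj₂ (proj₂ tailSplit)))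

  |G| : length G ≡ t
  |G| = proj₂ (proj₂ (proj₂ (proj₂ tailSplit)))

  |O| : length O ≡ R
  |O| = trans (length-ones _ (y ++ b)) (#1-++ y b)

  product : List ℕ
  product = O ++ ones 1 x ++ G ++ (zeros 1 x ++ F)

  -- The four blocks are the zeros of `x y b`, cut before the last `t`, and its ones, cut behind
  -- those of `x`.
  strangeSide : conj (m + r) (comp (comp (wOf (m + r) (compl r (decode (x ++ y ++ b)))) (w0P (m + r) m)) (w0P' (m + r) m t)) ≡ product
  strangeSide = conj-twisted (x ++ y ++ b) (zeros 1 x ++ F) G (ones 1 x) O #0β #1β zerosβ (ones-++ 1 x (y ++ b))
    (trans (cong (_+ t) (trans (length-++ (zeros 1 x)) (cong₂ _+_ (length-ones 1 (map not x)) |F|))) Q+t≡m)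
    |G| (length-ones 1 x) (trans (cong (t +_) |O|) t+R≡r)
    where
    #1β : #1 (x ++ y ++ b) ≡ r
    #1β = trans (#1-++ x (y ++ b)) (trans (cong (t +_) (#1-++ y b)) t+R≡r)
    #0β : #0 (x ++ y ++ b) ≡ m
    #0β = begin
      #0 (x ++ y ++ b)         ≡⟨ #0-++ x (y ++ b) ⟩
      #0 x + #0 (y ++ b)       ≡⟨ cong (#0 x +_) (trans (sym (length-ones _ (map not (y ++ b)))) tailZeros) ⟩
      #0 x + (length y + t)    ≡⟨ sym (+-assoc (#0 x) (length y) t) ⟩
      Q + t                    ≡⟨ Q+t≡m ⟩
      m ∎
    zerosβ : zeros 1 (x ++ y ++ b) ≡ (zeros 1 x ++ F) ++ G
    zerosβ = trans (zeros-++ 1 x (y ++ b)) (trans (cong (zeros 1 x ++_) tail≡F++G) (sym (++-assoc (zeros 1 x) F G)))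

  0y : List Bool
  0y = replicate (length y) false

  -- The strings of η¹ and η², completed to `n` bits: the trailing ones of `B₁` widen its rectangle
  -- to `r + t` columns, and the leading zeros of `B₂` are empty rows that bring it to `m + t` rows.
  B₁ B₂ : List Bool
  B₁ = replicate R true ++ x ++ 0y ++ replicate t true
  B₂ = replicate (length x) false ++ y ++ b

  phiJ-B₁ : phiJ (m + r) (r + t) (decode B₁) ≡
    (range 1 R ++ ones (suc R) x ++ range (suc (R + length x + length y)) t) ++ (zeros (suc R) x ++ range (suc (R + length x)) (length y))
  phiJ-B₁ = trans (phiJ-decode B₁ |B₁| #1B₁) (cong₂ _++_ ones₁ zeros₁)
    where
    |B₁| : length B₁ ≡ m + r
    |B₁| = begin
      length B₁ ≡⟨ trans (length-++ (replicate R true)) (cong₂ _+_ (length-replicate R)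
         (trans (length-++ x) (cong (length x +_) (trans (length-++ 0y) (cong₂ _+_ (length-replicate (length y)) (length-replicate t)))))) ⟩
      R + (length x + (length y + t)) ≡⟨ solveℕ 4 (λ R x y t → R :+ (x :+ (y :+ t)) := (x :+ y) :+ (t :+ R)) refl R (length x) (length y) t ⟩
      m + (t + R) ≡⟨ cong (m +_) t+R≡r ⟩
      m + r ∎
    #1B₁ : #1 B₁ ≡ r + t
    #1B₁ = begin
      #1 B₁ ≡⟨ trans (#1-++ (replicate R true) _) (cong₂ _+_ (#1-replicate-true R)
         (trans (#1-++ x _) (cong (t +_) (trans (#1-++ 0y _) (cong₂ _+_ (#1-replicate-false (length y)) (#1-replicate-true t)))))) ⟩
      R + (t + t) ≡⟨ solveℕ 2 (λ R t → R :+ (t :+ t) := (t :+ R) :+ t) refl R t ⟩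
      t + R + t   ≡⟨ cong (_+ t) t+R≡r ⟩
      r + t ∎
    ones₁ : ones 1 B₁ ≡ range 1 R ++ ones (suc R) x ++ range (suc (R + length x + length y)) t
    ones₁ rewrite ones-++ 1 (replicate R true) (x ++ 0y ++ replicate t true) | length-replicate R {true}
      | ones-++ (suc R) x (0y ++ replicate t true) | ones-++ (suc (R + length x)) 0y (replicate t true)
      | length-replicate (length y) {false} | ones-replicate-false (suc (R + length x)) (length y)
      | ones-replicate-true 1 R | ones-replicate-true (suc (R + length x + length y)) t = refl
    zeros₁ : zeros 1 B₁ ≡ zeros (suc R) x ++ range (suc (R + length x)) (length y)
    zeros₁ rewrite zeros-++ 1 (replicate R true) (x ++ 0y ++ replicate t true) | length-replicate R {true}
      | zeros-++ (suc R) x (0y ++ replicate t true) | zeros-++ (suc (R + length x)) 0y (replicate t true)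
      | length-replicate (length y) {false} | zeros-replicate-false (suc (R + length x)) (length y)
      | zeros-replicate-true 1 R | zeros-replicate-true (suc (R + length x + length y)) t
      | ++-identityʳ (range (suc (R + length x)) (length y)) = refl

  phiJ-B₂ : phiJ (m + r) (r ∸ t) (decode B₂) ≡ O ++ range 1 (length x) ++ F ++ G
  phiJ-B₂ = trans (phiJ-decode B₂ |B₂| #1B₂) (cong₂ _++_ ones₂ zeros₂)
    where
    0x = replicate (length x) false
    |B₂| : length B₂ ≡ m + r
    |B₂| = trans (length-++ 0x) (trans (cong₂ _+_ (length-replicate (length x)) (length-++ y)) (sym (+-assoc (length x) (length y) r)))
    #1B₂ : #1 B₂ ≡ r ∸ t
    #1B₂ = trans (#1-++ 0x _) (trans (cong₂ _+_ (#1-replicate-false (length x)) (#1-++ y b)) (sym r∸t≡R))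
    ones₂ : ones 1 B₂ ≡ O
    ones₂ rewrite ones-++ 1 0x (y ++ b) | length-replicate (length x) {false} | ones-replicate-false 1 (length x) = refl
    zeros₂ : zeros 1 B₂ ≡ range 1 (length x) ++ F ++ G
    zeros₂ = trans (zeros-++ 1 0x (y ++ b)) (cong₂ _++_ (zeros-replicate-false 1 (length x))
      (trans (cong (λ k → zeros (suc k) (y ++ b)) (length-replicate (length x))) tail≡F++G))

  -- The pieces of `B₁` have lengths `R`, `length x`, `length y`, `t`, as do the blocks of `W`.
  -- Hence its constant pieces select `O`, `F` and `G` entire, and `x` selects its own ones and
  -- zeros from `range 1 (length x)`.
  affineSide : comp (phiJ (m + r) (r ∸ t) (decode B₂)) (phiJ (m + r) (r + t) (decode B₁)) ≡ product
  affineSide = begin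
    comp (phiJ (m + r) (r ∸ t) (decode B₂)) (phiJ (m + r) (r + t) (decode B₁)) ≡⟨ cong₂ comp phiJ-B₂ phiJ-B₁ ⟩
    comp W ((range 1 R ++ ones (suc R) x ++ range (suc (R + length x + length y)) t) ++ (zeros (suc R) x ++ range (suc (R + length x)) (length y)))
      ≡⟨ trans (comp-++ W (range 1 R ++ ones (suc R) x ++ range (suc (R + length x + length y)) t) _)
           (cong₂ _++_ (trans (comp-++ W (range 1 R) _) (cong (comp W (range 1 R) ++_) (comp-++ W (ones (suc R) x) _))) (comp-++ W (zeros (suc R) x) _)) ⟩
    (comp W (range 1 R) ++ comp W (ones (suc R) x) ++ comp W (range (suc (R + length x + length y)) t)) ++ (comp W (zeros (suc R) x) ++ comp W (range (suc (R + length x)) (length y)))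
      ≡⟨ cong₂ _++_ (cong₂ _++_ first (cong₂ _++_ second third)) (cong₂ _++_ fourth fifth) ⟩
    (O ++ ones 1 x ++ G) ++ (zeros 1 x ++ F) ≡⟨ shuffle O (ones 1 x) G (zeros 1 x ++ F) ⟩
    product ∎
    where
    W = O ++ range 1 (length x) ++ F ++ G
    shuffle : ∀ (p q r s : List ℕ) → (p ++ q ++ r) ++ s ≡ p ++ q ++ r ++ s
    shuffle p q r s = solve (++-monoid ℕ)
    |O++range| : length (O ++ range 1 (length x)) ≡ R + length x
    |O++range| = trans (length-++ O) (cong₂ _+_ |O| (length-range 1 (length x)))
    first : comp W (range 1 R) ≡ O
    first = map-row-range [] O (range 1 (length x) ++ F ++ G) refl |O|
    second : comp W (ones (suc R) x) ≡ ones 1 x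
    second = map-row-ones O 1 x (F ++ G) |O|
    third : comp W (range (suc (R + length x + length y)) t) ≡ G
    third = trans (cong (λ l → comp l (range (suc (R + length x + length y)) t)) (assoc O (range 1 (length x)) F G))
      (map-row-range ((O ++ range 1 (length x)) ++ F) G [] (trans (length-++ (O ++ range 1 (length x))) (cong₂ _+_ |O++range| |F|)) |G|)
      where
      assoc : ∀ (p q r s : List ℕ) → p ++ q ++ r ++ s ≡ ((p ++ q) ++ r) ++ s ++ []
      assoc p q r s = solve (++-monoid ℕ)
    fourth : comp W (zeros (suc R) x) ≡ zeros 1 x
    fourth = subst (λ k → comp (O ++ range 1 k ++ F ++ G) (zeros (suc R) x) ≡ zeros 1 x) (length-map not x)
      (map-row-ones O 1 (map not x) (F ++ G) |O|)
    fifth : comp W (range (suc (R + length x)) (length y)) ≡ F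
    fifth = trans (cong (λ l → comp l (range (suc (R + length x)) (length y))) (sym (++-assoc O (range 1 (length x)) (F ++ G))))
      (map-row-range (O ++ range 1 (length x)) F G |O++range| |F|)

  module _ {ρ} (ρ≋ : ρ ≋ decode (y ++ (b ++ x) ++ 0y)) where

    cut : ∀ as bs {c} → #1 as ≡ c → y ++ (b ++ x) ++ 0y ≡ as ++ bs → ρ ≋ (decode (replicate c true ++ bs) ++ decode as)
    cut as bs #as e i = trans (ρ≋ i) (cong (λ l → row l (suc i)) (trans (cong decode e) (decode-++ as bs #as)))

    #0-true++ : ∀ c bs → #0 (replicate c true ++ bs) ≡ #0 bs
    #0-true++ c bs = trans (#0-++ (replicate c true) bs) (cong (_+ #0 bs) (#0-replicate-true c))

    #0-x0y : #0 (x ++ 0y) ≡ Q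
    #0-x0y = trans (#0-++ x 0y) (cong (#0 x +_) (#0-replicate-false (length y)))

    low : List ℕ
    low = decode (replicate R true ++ x ++ 0y)

    |low| : length low ≡ m ∸ t
    |low| = trans (length-decode (replicate R true ++ x ++ 0y)) (trans (#0-true++ R (x ++ 0y)) (trans #0-x0y (sym m∸t≡Q)))

    ρ≋low++ : ρ ≋ (low ++ decode (y ++ b))
    ρ≋low++ = cut (y ++ b) (x ++ 0y) (#1-++ y b) (assoc y b x 0y)
      where
      assoc : ∀ (y b x z : List Bool) → y ++ (b ++ x) ++ z ≡ (y ++ b) ++ x ++ z
      assoc y b x z = solve (++-monoid Bool)

    eta₁ : rowsFrom ρ 0 (m ∸ t) ≡ decode B₁
    eta₁ = begin
      rowsFrom ρ 0 (m ∸ t)                                   ≡⟨ rowsFrom-≋ [] low (decode (y ++ b)) ρ≋low++ refl |low| ⟩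
      low                                                    ≡⟨ sym (decode-++-true (replicate R true ++ x ++ 0y) t) ⟩
      decode ((replicate R true ++ x ++ 0y) ++ replicate t true) ≡⟨ cong decode (assoc (replicate R true) x 0y (replicate t true)) ⟩
      decode B₁ ∎
      where
      assoc : ∀ (p q r s : List Bool) → (p ++ q ++ r) ++ s ≡ p ++ q ++ r ++ s
      assoc p q r s = solve (++-monoid Bool)

    eta₂ : rowsFrom ρ (m ∸ t) (m + t) ≡ decode B₂
    eta₂ = rowsFrom-≋ low (decode B₂) [] padded |low| |B₂|
      where
      padded : ρ ≋ (low ++ decode B₂ ++ [])
      padded i = begin
        row ρ (suc i)                                                   ≡⟨ ρ≋low++ i ⟩
        row (low ++ decode (y ++ b)) (suc i)                            ≡⟨ sym (row-++-zeros (low ++ decode (y ++ b)) (length x) i) ⟩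
        row ((low ++ decode (y ++ b)) ++ replicate (length x) 0) (suc i) ≡⟨ cong (λ l → row l (suc i)) (++-assoc low _ _) ⟩
        row (low ++ decode (y ++ b) ++ replicate (length x) 0) (suc i)
          ≡⟨ cong (λ l → row (low ++ l) (suc i)) (trans (sym (decode-false-++ (length x) (y ++ b))) (sym (++-identityʳ (decode B₂)))) ⟩
        row (low ++ decode B₂ ++ []) (suc i) ∎
      |B₂| : length (decode B₂) ≡ m + t
      |B₂| = begin
        length (decode B₂)       ≡⟨ length-decode B₂ ⟩
        #0 B₂                    ≡⟨ #0-++ (replicate (length x) false) (y ++ b) ⟩
        #0 (replicate (length x) false) + #0 (y ++ b)
          ≡⟨ cong₂ _+_ (#0-replicate-false (length x)) (trans (sym (length-ones _ (map not (y ++ b)))) tailZeros) ⟩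
        length x + (length y + t) ≡⟨ sym (+-assoc (length x) (length y) t) ⟩
        m + t ∎

    sOf≡t : sOf m r ρ ≡ t
    -- Cut `b` as `u v` with `d` zeros in `u` and `t` in `v`. Then `v x 0^|y|` has `m` zeros, so it
    -- gives the bottom `m` rows. The ones of `y u` before it number `d + #1 u`, which is
    -- `length u`; so the first `r` bits are these ones and `v`, with `t` zeros among them.
    sOf≡t with split-#0 b {d} {t} (trans #0b (+-comm t d))
    ... | u , v , b≡ , #0u , #0v = begin
      diag0 (compl r (rowsFrom ρ 0 m)) ≡⟨ cong (λ l → diag0 (compl r l)) rows ⟩
      diag0 (compl r (decode (replicate c true ++ v ++ x ++ 0y))) ≡⟨ diag0-compl-decode r _ ⟩
      #0 (take r (replicate c true ++ v ++ x ++ 0y))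
        ≡⟨ cong #0 (trans (cong (take r) (sym (++-assoc (replicate c true) v (x ++ 0y)))) (take-length-++ (replicate c true ++ v) (x ++ 0y) |cv|)) ⟩
      #0 (replicate c true ++ v)       ≡⟨ #0-true++ c v ⟩
      #0 v                             ≡⟨ #0v ⟩
      t ∎
      where
      c = d + #1 u
      assoc : ∀ (y u v x z : List Bool) → y ++ ((u ++ v) ++ x) ++ z ≡ (y ++ u) ++ v ++ x ++ z
      assoc y u v x z = solve (++-monoid Bool)
      rows : rowsFrom ρ 0 m ≡ decode (replicate c true ++ v ++ x ++ 0y)
      rows = rowsFrom-≋ [] (decode (replicate c true ++ v ++ x ++ 0y)) (decode (y ++ u))
        (cut (y ++ u) (v ++ x ++ 0y) (#1-++ y u) (trans (cong (λ l → y ++ (l ++ x) ++ 0y) b≡) (assoc y u v x 0y))) refl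
        (begin
          length (decode (replicate c true ++ v ++ x ++ 0y)) ≡⟨ length-decode (replicate c true ++ v ++ x ++ 0y) ⟩
          #0 (replicate c true ++ v ++ x ++ 0y)              ≡⟨ #0-true++ c (v ++ x ++ 0y) ⟩
          #0 (v ++ x ++ 0y)                                  ≡⟨ trans (#0-++ v (x ++ 0y)) (cong₂ _+_ #0v #0-x0y) ⟩
          t + Q                                              ≡⟨ trans (+-comm t Q) Q+t≡m ⟩
          m ∎)
      |cv| : length (replicate c true ++ v) ≡ r
      |cv| = begin
        length (replicate c true ++ v)  ≡⟨ trans (length-++ (replicate c true)) (cong (_+ length v) (length-replicate c)) ⟩
        d + #1 u + length v             ≡⟨ cong (λ z → z + #1 u + length v) (sym #0u) ⟩
        #0 u + #1 u + length v          ≡⟨ cong (_+ length v) (#0+#1 u) ⟩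
        length u + length v             ≡⟨ sym (length-++ u) ⟩
        length (u ++ v)                 ≡⟨ cong length (sym b≡) ⟩
        r ∎

-- Comparison of the indices, field by field.

flIdx-cong : ∀ {u u′ v v′ w w′ e e′} → u ≡ u′ → v ≡ v′ → w ≡ w′ → e ≡ e′ → flIdx u v w e ≡ flIdx u′ v′ w′ e′
flIdx-cong refl refl refl refl = refl

-- The lengths and counts enter as equations, so that matching on `refl` identifies `m`, `r`, `t`,
-- `d` with the quantities of `Twist`.
third-index : ∀ {m r t d ν ρ} b x y → length b ≡ r → length x + length y ≡ m → #1 x ≡ t → #1 y ≡ d → #0 b ≡ t + d →
  bits r ν ≡ b ++ x ++ y → ρ ≋ decode (y ++ (b ++ x) ++ replicate (length y) false) →
  sOf m r ρ ≡ t ×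
  conj (m + r) (comp (comp (wOf (m + r) (compl r (phiRot r r ν))) (w0P (m + r) m)) (w0P' (m + r) m t)) ≡
    comp (phiJ (m + r) (r ∸ t) (rowsFrom ρ (m ∸ t) (m + t))) (phiJ (m + r) (r + t) (rowsFrom ρ 0 (m ∸ t)))
third-index {ν = ν} {ρ} b x y refl refl refl refl #0b bits≡ ρ≋ = sOf≡t {ρ} ρ≋ , (begin
  twist (phiRot r r ν)        ≡⟨ cong twist rotated ⟩
  twist (decode (x ++ y ++ b)) ≡⟨ strangeSide ⟩
  product                     ≡⟨ sym affineSide ⟩
  comp (phiJ (m + r) (r ∸ t) (decode B₂)) (phiJ (m + r) (r + t) (decode B₁))
    ≡⟨ cong₂ (λ k l → comp (phiJ (m + r) (r ∸ t) k) (phiJ (m + r) (r + t) l)) (sym (eta₂ {ρ} ρ≋)) (sym (eta₁ {ρ} ρ≋)) ⟩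
  comp (phiJ (m + r) (r ∸ t) (rowsFrom ρ (m ∸ t) (m + t))) (phiJ (m + r) (r + t) (rowsFrom ρ 0 (m ∸ t))) ∎)
  where
  open ≡-Reasoning
  open Twist b x y #0b
  twist : List ℕ → List ℕ
  twist l = conj (m + r) (comp (comp (wOf (m + r) (compl r l)) (w0P (m + r) m)) (w0P' (m + r) m t))
  rotated : phiRot r r ν ≡ decode (x ++ y ++ b)
  rotated = cong decode (trans (cong (λ l → drop r l ++ take r l) bits≡)
    (trans (cong₂ _++_ (drop-length-++ b (x ++ y) refl) (take-length-++ b (x ++ y) refl)) (++-assoc x y b)))

-- Since `b` has length `r` and the whole string has `r` ones, the zeros of `b` are as many as the
-- ones after it. By `d ≤ D` this number is `(D ∸ d) + d`, so the rest can be cut before its last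
-- `d` ones.
cut-bits : ∀ {m r ν d} → InRect m r ν → d ≤ diag0 (compl r ν) → ∃[ b ] ∃[ x ] ∃[ y ]
  bits r ν ≡ b ++ x ++ y × length b ≡ r × length x + length y ≡ m ×
  #1 x ≡ diag0 (compl r ν) ∸ d × #1 y ≡ d × #0 b ≡ diag0 (compl r ν) ∸ d + d
cut-bits {m} {r} {ν} {d} ν⊆ d≤D with split-length (bits r ν) r m (trans (Bits.length-bits ν⊆) (+-comm m r))
... | b , b″ , bits≡ , |b| , |b″| = result (split-#1 b″ #1b″)
  where
  open ≡-Reasoning
  D = diag0 (compl r ν)
  #0b : #0 b ≡ D ∸ d + d
  #0b = sym (begin
    D ∸ d + d                            ≡⟨ m∸n+n≡m d≤D ⟩
    diag0 (compl r ν)                    ≡⟨ cong (λ l → diag0 (compl r l)) (sym (Bits.decode-bits ν⊆)) ⟩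
    diag0 (compl r (decode (bits r ν)))  ≡⟨ diag0-compl-decode r (bits r ν) ⟩
    #0 (take r (bits r ν))               ≡⟨ cong #0 (trans (cong (take r) bits≡) (take-length-++ b b″ |b|)) ⟩
    #0 b ∎)
  #1b″ : #1 b″ ≡ D ∸ d + d
  #1b″ = trans (+-cancelˡ-≡ (#1 b) _ _ (begin
    #1 b + #1 b″      ≡⟨ sym (#1-++ b b″) ⟩
    #1 (b ++ b″)      ≡⟨ cong #1 (sym bits≡) ⟩
    #1 (bits r ν)     ≡⟨ Bits.#1-bits ν⊆ ⟩
    r                 ≡⟨ sym |b| ⟩
    length b          ≡⟨ sym (#0+#1 b) ⟩
    #0 b + #1 b       ≡⟨ +-comm (#0 b) (#1 b) ⟩
    #1 b + #0 b ∎)) #0b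
  result : (∃[ x ] ∃[ y ] b″ ≡ x ++ y × #1 x ≡ D ∸ d × #1 y ≡ d) → _
  result (x , y , b″≡ , #x , #y) = b , x , y , trans bits≡ (cong (b ++_) b″≡) , |b| ,
    trans (sym (length-++ x)) (trans (cong length (sym b″≡)) |b″|) , #x , #y , #0b

mainTheorem1 : (m r : ℕ) → 1 ≤ m → 1 ≤ r →
    (lam mu nu : List ℕ) (d : ℕ) →
    InRect m r lam → InRect m r mu → InRect m r nu →
    sum lam + sum mu ≡ sum nu + (m + r) * d →
    d ≤ diag0 (compl r nu) →
    (rho : List ℕ) → AddHooks (m + r) r nu d rho →
    GammaT (m + r) (PsiPC m r (GammaSD r (grIdx lam mu nu d)))
    ≡ PhiFl m r (kIdx lam mu rho)
mainTheorem1 m r _ 1≤r lam mu nu d lam⊆ mu⊆ nu⊆ _ d≤D rho hooks with cut-bits nu⊆ d≤D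
... | b , x , y , bits≡ , |b| , |xy| , #x , #y , #0b =
  flIdx-cong (conj-wOf≡phiJ lam⊆) (conj-wOf≡phiJ mu⊆)
    (trans w≡ (cong (λ s → comp (phiJ n (r ∸ s) (rowsFrom rho (m ∸ s) (m + s))) (phiJ n (r + s) (rowsFrom rho 0 (m ∸ s)))) (sym s≡t)))
    (trans (reverse-degPeak m r t) (cong (degPeak n r) (sym s≡t)))
  where
  n = m + r
  t = diag0 (compl r nu) ∸ d
  -- `addHooks-decode` reads the hook length and the head column off the string, as its counts of
  -- zeros and ones.
  hooks′ : AddHooks (#0 (bits r nu) + #1 (bits r nu)) (#1 (bits r nu)) nu d rho
  hooks′ = subst₂ (λ p q → AddHooks (p + q) q nu d rho) (sym (Bits.#0-bits nu⊆)) (sym (Bits.#1-bits nu⊆)) hooks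
  rho≋ : rho ≋ decode (y ++ (b ++ x) ++ replicate (length y) false)
  rho≋ = addHooks-decode (b ++ x) y (subst (1 ≤_) (sym (Bits.#1-bits nu⊆)) 1≤r) (proj₁ (proj₂ nu⊆))
    (sym (Bits.decode-bits nu⊆)) (trans (++-assoc b x y) (sym bits≡)) hooks′ #y
  s≡t : sOf m r rho ≡ t
  s≡t = proj₁ (third-index {ν = nu} b x y |b| |xy| #x #y #0b bits≡ rho≋)
  w≡ = proj₂ (third-index {ν = nu} b x y |b| |xy| #x #y #0b bits≡ rho≋)
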